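{- Let $n$ be a positive integer. For $m\in\{0,1,2\}$, we have $$C_m(n)=\sum_{j=-\infty}^{\infty}(-1)^j\,u_m\big(n-j(3j-1)/2\big).$$
   Context: Unimodal compositions. A composition of a positive integer $n$ is a sequence $(\lambda_1,\ldots,\lambda_r)$ of positive integers (parts) with sum $n$. It is unimodal if there exists $t\in\{1,\ldots,r\}$ with $\lambda_1\leqslant\cdots\leqslant\lambda_t$ and $\lambda_t\geqslant\cdots\geqslant\lambda_r$. For $n\geqslant 1$, $u_0(n)$ is the number of unimodal compositions of $n$, and $u_0(0)=0$. For $m\geqslant1$ and $n\geqslant0$, $u_m(n)$ is the number of unimodal compositions of $n+m$ in which the maximal part appears exactly $m$ times; in particular $u_m(0)=1$. Convention: $u_m(n)=0$ for $n<0$ (so the sum over $j\in\mathbb{Z}$ has finitely many nonzero terms). Crank. For a partition $\lambda=(\lambda_1\geqslant\lambda_2\geqslant\cdots)$, let $\omega(\lambda)$ be the number of parts of $\lambda$ equal to $1$, and $\mu(\lambda)$ the number of parts of $\lambda$ larger than $\omega(\lambda)$. The crank is $c(\lambda)=\lambda_1$ (the largest part) if $\omega(\lambda)=0$, and $c(\lambda)=\mu(\lambda)-\omega(\lambda)$ if $\omega(\lambda)>0$. For an integer $n\geqslant 2$: $C_0(n)$ is the number of partitions $\lambda$ of $n$ with $c(\lambda)>0$; $C_1(n)$ is the number of partitions $\lambda$ of $n$ with $c(\lambda)\geqslant0$; $C_2(n)$ is the number of partitions $\lambda$ of $n$ with $c(\lambda)=0$. Moreover, by definition, $C_0(1)=1$,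 $C_1(1)=0$, $C_2(1)=-1$. -}

module Defs where

open import Data.Bool.Base using (if_then_else_)
open import Data.Empty using (⊥)
open import Data.Fin.Base using (Fin; zero; suc; toℕ)
open import Data.Fin.Properties using (any?)
open import Data.Integer.Base as ℤ using (ℤ; +_; -[1+_]; 0ℤ; 1ℤ; -1ℤ; ∣_∣)
open import Data.Integer.DivMod using (_/_)
import Data.Integer.Properties as ℤ
open import Data.List.Base
  using (List; []; _∷_; concatMap; drop; filter; length; take)
open import Data.List.Extrema.Nat using (max)
open import Data.List.Membership.Propositional using (_∈_; find)
open import Data.List.Membership.Propositional.Properties
  using (∈-concatMap⁺; ∈-concatMap⁻)
open import Data.List.Relation.Unary.All as All using (All; []; _∷_)
open import Data.List.Relation.Unary.AllPairs using ([]; _∷_)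
open import Data.List.Relation.Unary.Any as Any using (Any; here; there)
open import Data.List.Relation.Unary.Linked using (Linked; linked?)
open import Data.List.Relation.Unary.Unique.Propositional using (Unique)
open import Data.List.Relation.Unary.Unique.Propositional.Properties using (++⁺)
open import Data.Nat.Base
  using (ℕ; zero; suc; _+_; _≤_; _<_; _≥_; s≤s; z≤n; NonZero)
open import Data.Nat.ListAction using (sum)
open import Data.Nat.Properties using (_≟_; _≤?_; _≥?_; _<?_; suc-injective)
open import Data.Product.Base using (∃; _×_; _,_; proj₁)
open import Relation.Binary.PropositionalEquality
  using (_≡_; _≢_; refl; sym; trans; cong)
open import Relation.Nullary.Decidable using (does; _×-dec_)
open import Relation.Unary using (Decidable)

IsComposition : ℕ → List ℕ → Set
IsComposition n xs = All (0 <_) xs × sum xs ≡ n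

-- The compositions of n + 1 arise from those of n by prepending a part 1 or
-- by increasing the first part by one.
grow : List ℕ → List (List ℕ)
grow []       = (1 ∷ []) ∷ []
grow (x ∷ xs) = (1 ∷ x ∷ xs) ∷ (suc x ∷ xs) ∷ []

compositions : ℕ → List (List ℕ)
compositions zero    = [] ∷ []
compositions (suc n) = concatMap grow (compositions n)

-- compositions n lists each composition of n exactly once.

private
  grow-sound : ∀ {n} ys {xs} → IsComposition n ys → xs ∈ grow ys →
               IsComposition (suc n) xs
  grow-sound []       (_ , eq)      (here refl)         =
    s≤s z≤n ∷ [] , cong suc eq
  grow-sound (_ ∷ _)  (ps , eq)     (here refl)         =
    s≤s z≤n ∷ ps , cong suc eq
  grow-sound (_ ∷ _)  (_ ∷ ps , eq) (there (here refl)) =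
    s≤s z≤n ∷ ps , cong suc eq

  ∈-grow₁ : ∀ ys → (1 ∷ ys) ∈ grow ys
  ∈-grow₁ []      = here refl
  ∈-grow₁ (_ ∷ _) = here refl

  shrink : List ℕ → List ℕ
  shrink (suc (suc x) ∷ xs) = suc x ∷ xs
  shrink (_ ∷ xs)           = xs
  shrink []                 = []

  shrink-grow : ∀ ys {xs} → All (0 <_) ys → xs ∈ grow ys → shrink xs ≡ ys
  shrink-grow []          _       (here refl)         = refl
  shrink-grow (_ ∷ _)     _       (here refl)         = refl
  shrink-grow (suc _ ∷ _) _       (there (here refl)) = refl
  shrink-grow (zero ∷ _)  (() ∷ _) (there (here refl))

  grow-unique : ∀ ys → All (0 <_) ys → Unique (grow ys)
  grow-unique []          _        = [] ∷ []
  grow-unique (zero ∷ _)  (() ∷ _)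
  grow-unique (suc _ ∷ _) _        = ((λ ()) ∷ []) ∷ [] ∷ []

  concatMap-grow-unique : ∀ {yss} → All (All (0 <_)) yss → Unique yss →
                          Unique (concatMap grow yss)
  concatMap-grow-unique {[]}       _        _        = []
  concatMap-grow-unique {ys ∷ yss} (p ∷ ps) (d ∷ ds) =
    ++⁺ (grow-unique ys p) (concatMap-grow-unique ps ds)
        λ (i , j) → disjoint ps d (shrink-grow ys p i) (∈-concatMap⁻ grow {xs = yss} j)
    where
    disjoint : ∀ {zss xs} → All (All (0 <_)) zss → All (ys ≢_) zss →
               shrink xs ≡ ys → Any (λ zs → xs ∈ grow zs) zss → ⊥
    disjoint (q ∷ _)  (e ∷ _)  eq (here k)  = e (trans (sym eq) (shrink-grow _ q k))
    disjoint (_ ∷ qs) (_ ∷ es) eq (there k) = disjoint qs es eq k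

compositions-sound : ∀ n {xs} → xs ∈ compositions n → IsComposition n xs
compositions-sound zero    (here refl) = [] , refl
compositions-sound (suc n) i
  with ys , j , k ← find (∈-concatMap⁻ grow {xs = compositions n} i)
  = grow-sound ys (compositions-sound n j) k

compositions-complete : ∀ n {xs} → IsComposition n xs → xs ∈ compositions n
compositions-complete zero    {[]}              _             = here refl
compositions-complete zero    {zero ∷ _}        (() ∷ _ , _)
compositions-complete (suc n) {zero ∷ _}        (() ∷ _ , _)
compositions-complete (suc n) {suc zero ∷ xs}   (_ ∷ ps , eq) =
  ∈-concatMap⁺ grow (Any.map (λ { refl → ∈-grow₁ xs })
    (compositions-complete n (ps , suc-injective eq)))
compositions-complete (suc n) {suc (suc x) ∷ xs} (_ ∷ ps , eq) =
  ∈-concatMap⁺ grow (Any.map (λ { refl → there (here refl) })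
    (compositions-complete n (s≤s z≤n ∷ ps , suc-injective eq)))

compositions-unique : ∀ n → Unique (compositions n)
compositions-unique zero    = [] ∷ []
compositions-unique (suc n) = concatMap-grow-unique
  (All.tabulate λ i → proj₁ (compositions-sound n i)) (compositions-unique n)

largest : List ℕ → ℕ
largest = max 0

multiplicity : ℕ → List ℕ → ℕ
multiplicity k xs = length (filter (_≟ k) xs)

-- The peak position t ∈ {1,…,r} is represented by t - 1; both lists below
-- contain the part at position t.
Unimodal : List ℕ → Set
Unimodal xs = ∃ λ (t : Fin (length xs)) →
  Linked _≤_ (take (suc (toℕ t)) xs) × Linked _≥_ (drop (toℕ t) xs)

unimodal? : Decidable Unimodal
unimodal? xs = any? λ t →
  linked? _≤?_ (take (suc (toℕ t)) xs) ×-dec linked? _≥?_ (drop (toℕ t) xs)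

unimodalCompositions : ℕ → List (List ℕ)
unimodalCompositions n = filter unimodal? (compositions n)

u : ℕ → ℤ → ℕ
u _       -[1+ _ ]  = 0
u zero    (+ zero)  = 0
u zero    (+ suc n) = length (unimodalCompositions (suc n))
u (suc k) (+ n)     =
  length (filter (λ xs → multiplicity (largest xs) xs ≟ suc k)
                 (unimodalCompositions (n + suc k)))

partitions : ℕ → List (List ℕ)
partitions n = filter (linked? _≥?_) (compositions n)

ω : List ℕ → ℕ
ω = multiplicity 1

μ : List ℕ → ℕ
μ xs = length (filter (ω xs <?_) xs)

crank : List ℕ → ℤ
crank xs = if does (ω xs ≟ 0) then + largest xs else (+ μ xs) ℤ.- (+ ω xs)

C : Fin 3 → (n : ℕ) .{{_ : NonZero n}} → ℤ
C zero             1 = 1ℤ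
C (suc zero)       1 = 0ℤ
C (suc (suc zero)) 1 = -1ℤ
C zero             n@(suc (suc _)) =
  + length (filter (λ xs → 0ℤ ℤ.<? crank xs) (partitions n))
C (suc zero)       n@(suc (suc _)) =
  + length (filter (λ xs → 0ℤ ℤ.≤? crank xs) (partitions n))
C (suc (suc zero)) n@(suc (suc _)) =
  + length (filter (λ xs → crank xs ℤ.≟ 0ℤ) (partitions n))

-- The division is exact.
pentagonal : ℤ → ℤ
pentagonal j = (j ℤ.* (+ 3 ℤ.* j ℤ.- 1ℤ)) / + 2

-- (-1)^j for an integer exponent depends only on the parity of j, hence on ∣ j ∣.
sign : ℤ → ℤ
sign j = -1ℤ ℤ.^ ∣ j ∣

symmetricSum : (ℤ → ℤ) → ℕ → ℤ
symmetricSum f zero    = f 0ℤ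
symmetricSum f (suc N) = symmetricSum f N ℤ.+ f (+ suc N) ℤ.+ f -[1+ N ]

-- s is the sum of f over all of ℤ, where f has only finitely many nonzero values.
IsSumOverℤ : (ℤ → ℤ) → ℤ → Set
IsSumOverℤ f s = ∃ λ N →
  (∀ j → N < ∣ j ∣ → f j ≡ 0ℤ) × s ≡ symmetricSum f N

module Submission where

-- Write q-series as integer sequences. Classifying by the largest part gives
--   Σ u_m(n) qⁿ = F_m := Σ_p q^{pm} / (q)_p²   for m ≥ 1, and F_1 - F_2 for m = 0.
-- The partitions of nonnegative crank are those whose number of ones is at most the side d
-- of the d × (d + 1) Durfee rectangle, and those of crank zero have exactly w ones and w parts
-- larger than w; this gives H_1 and (1 - q) H_2, where H_m := Σ_p q^{p² + pm} / (q)_p².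
-- Since
--   (1 - q^m) F_m = 2 F_{m+1} - F_{m+2}   and   H_m = 2 H_{m+1} - (1 - q^{m+1}) H_{m+2},
-- the series (q^m)_∞ F_m and H_m satisfy the same recurrence; both are 1 + O(q^m), so
-- descending induction on m shows that they agree. Finally (q)_∞ is expanded by Shanks'
-- finite form of the pentagonal number theorem.

open import Defs
open import Data.Bool.Base using (if_then_else_)
open import Data.Empty using (⊥)
open import Data.Fin.Base using (Fin; zero; suc; toℕ)
open import Data.Integer.Base as ℤ
  using (ℤ; +_; -[1+_]; 0ℤ; 1ℤ; -1ℤ; ∣_∣; _+_; _*_; _-_; -_; _≤_; _<_; +≤+; +<+; -<+; _^_)
open import Data.Integer.DivMod using (_/_)
import Data.Integer.Properties as ℤ
open import Data.Integer.Tactic.RingSolver using (solve-∀)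
open import Data.List.Base using (List; []; _∷_; _++_; length; map; filter)
open import Data.List.Extrema.Nat using (max≤v⁺; v≤max⁺)
open import Data.List.Membership.Propositional using (_∈_)
open import Data.List.Membership.Propositional.Properties
  using (∈-map⁺; ∈-map⁻; ∈-++⁺ˡ; ∈-++⁺ʳ; ∈-++⁻; ∈-filter⁺; ∈-filter⁻)
open import Data.List.Membership.Propositional.Properties.WithK using (unique∧set⇒bag)
open import Data.List.Properties
  using (length-map; length-++; ∷-injective; filter-accept; filter-reject)
open import Data.List.Relation.Binary.BagAndSetEquality using (∼bag⇒↭)
open import Data.List.Relation.Binary.Permutation.Propositional.Properties using (↭-length)
open import Data.List.Relation.Unary.All as All using (All; []; _∷_)
open import Data.List.Relation.Unary.Any as Any using (here; there)
open import Data.List.Relation.Unary.Linked as Linked using (Linked; []; [-]; _∷_; linked?)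
open import Data.List.Relation.Unary.Unique.Propositional using (Unique; []; _∷_)
import Data.List.Relation.Unary.Unique.Propositional.Properties as Unique
open import Data.Nat.Base as ℕ using (ℕ; zero; suc; z≤n; s≤s; NonZero; _≥_)
import Data.Nat.DivMod as ℕ
open import Data.Nat.ListAction using (sum)
open import Data.Nat.Properties as ℕ using (_≟_; _<?_; _≤?_)
open import Data.Product.Base using (∃; _×_; _,_; proj₁; proj₂)
open import Data.Sum.Base as Sum using (_⊎_; inj₁; inj₂; [_,_]′)
open import Function.Base using (_∘_)
open import Function.Bundles using (mk⇔)
open import Function.Definitions using (Injective)
open import Relation.Binary.PropositionalEquality
open import Relation.Nullary.Decidable using (does; yes; no)
open import Relation.Nullary.Negation using (¬_; contradiction)
open import Relation.Unary using (Decidable)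
open ≡-Reasoning

-- Causal series and the operators 1 - q^k

-- Both recurrences come from a second difference in m: combining the p-th terms for m, m + 1, m + 2
-- with coefficients 1, -2, 1 multiplies by (1 - q^p)², which kills p = 0 and turns 1/(q)_p² into
-- 1/(q)_{p-1}²; re-indexing gives back F or H. No product of series is used, only the operators 1 -
-- q^k. They are injective on causal series, so 1/(q)_p² is known through what (q)_p² does to it,
-- and generating functions are identified by cancelling such factors. Infinite sums and (q)_∞ are
-- replaced by truncations that agree below a bound, n + 1 when the coefficient of q^n is wanted.
-- The values at n = 1 are forced: partitions of crank zero account for the terms p ≥ 1 of (1 - q)
-- H_2 only. The term p = 0 is 1 - q and puts -1 into degree 1; this is C_2(1), and C_0 = C_1 - C_2
-- gives C_0(1) = 1.

Series : Set
Series = ℤ → ℤ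

infix 4 _≗_below_ _≐_
-- On causal series this is congruence modulo q^b. A shift by a natural number keeps the argument
-- below b, so `D` and `E` respect the relation.
_≗_below_ : Series → Series → ℤ → Set
f ≗ g below b = ∀ x → x < b → f x ≡ g x

_≐_ : Series → Series → Set
f ≐ g = ∀ x → f x ≡ g x

Causal : Series → Set
Causal f = ∀ x → x < 0ℤ → f x ≡ 0ℤ

shift : ℤ → Series → Series
shift c f x = f (x - c)

δ : Series
δ (+ 0) = 1ℤ
δ _     = 0ℤ

D : ℕ → Series → Series
D k f x = f x - f (x - + k)

-- Multiplication by the q-Pochhammer symbol (q^m)_k = (1 - q^m) ... (1 - q^{m+k-1}).
E : ℕ → ℕ → Series → Series
E zero    m f = f
E (suc k) m f = D m (E k (suc m) f)

x-k≤x : ∀ x k → x - + k ≤ x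
x-k≤x x k = subst (x - + k ≤_) (ℤ.+-identityʳ x) (ℤ.+-monoʳ-≤ x (ℤ.neg-mono-≤ (+≤+ ℕ.z≤n)))

x-k<b : ∀ {x b} k → x < b → x - + k < b
x-k<b k lt = ℤ.≤-<-trans (x-k≤x _ k) lt

x-suc<b : ∀ {x b} k → x < + suc b → x - + suc k < + b
x-suc<b {x} {b} k lt =
  ℤ.<-≤-trans (ℤ.+-monoˡ-< (- + suc k) lt)
    (subst (_≤ + b) (lemma (+ b) (+ k)) (x-k≤x (+ b) k))
  where
  lemma : ∀ b k → b - k ≡ (1ℤ + b) - (1ℤ + k)
  lemma = solve-∀

shift-causal : ∀ {f} k → Causal f → Causal (shift (+ k) f)
shift-causal k c x lt = c _ (x-k<b k lt)

x<1+∣x∣ : ∀ x → x < + suc ∣ x ∣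
x<1+∣x∣ (+ n)    = +<+ (ℕ.n<1+n n)
x<1+∣x∣ -[1+ n ] = -<+

≗⇒≐ : ∀ {f g} → (∀ b → f ≗ g below + b) → f ≐ g
≗⇒≐ h x = h (suc ∣ x ∣) x (x<1+∣x∣ x)

D-local : ∀ {b f g} k → f ≗ g below b → D k f ≗ D k g below b
D-local k h x lt = cong₂ _-_ (h x lt) (h _ (x-k<b k lt))

D-cong : ∀ {f g} k → f ≐ g → D k f ≐ D k g
D-cong k h x = cong₂ _-_ (h x) (h _)

D-causal : ∀ {f} k → Causal f → Causal (D k f)
D-causal k c x lt = cong₂ _-_ (c x lt) (c _ (x-k<b k lt))

D-comm : ∀ a b f → D a (D b f) ≐ D b (D a f)
D-comm a b f x =
  trans (cong (λ y → (f x - f (x - + b)) - (f (x - + a) - f y)) (arg x (+ a) (+ b)))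
        (val (f x) (f (x - + b)) (f (x - + a)) (f (x - + b - + a)))
  where
  arg : ∀ x a b → x - a - b ≡ x - b - a
  arg = solve-∀
  val : ∀ p q r s → (p - q) - (r - s) ≡ (p - r) - (q - s)
  val = solve-∀

D-shift : ∀ k c f → D k (shift c f) ≐ shift c (D k f)
D-shift k c f x = cong (λ y → f (x - c) - f y) (arg x c (+ k))
  where
  arg : ∀ x c k → x - k - c ≡ x - c - k
  arg = solve-∀

-- A value of `f` is the value of `D (suc k) f` plus an earlier value of `f`, so `f` is recovered
-- upwards from its zeros at negative arguments.
D-injective : ∀ {f g} k → Causal f → Causal g → D (suc k) f ≐ D (suc k) g → f ≐ g
D-injective {f} {g} k cf cg h = ≗⇒≐ below
  where
  below : ∀ b → f ≗ g below + b
  below zero    x lt = trans (cf x lt) (sym (cg x lt))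
  below (suc b) x lt = begin
    f x                                           ≡⟨ split (f x) (f (x - + suc k)) ⟩
    (f x - f (x - + suc k)) + f (x - + suc k)     ≡⟨ cong₂ _+_ (h x) (below b _ (x-suc<b k lt)) ⟩
    (g x - g (x - + suc k)) + g (x - + suc k)     ≡⟨ split (g x) (g (x - + suc k)) ⟨
    g x                                           ∎
    where
    split : ∀ p q → p ≡ (p - q) + q
    split = solve-∀

E-local : ∀ {b f g} k m → f ≗ g below b → E k m f ≗ E k m g below b
E-local zero    m h = h
E-local (suc k) m h = D-local m (E-local k (suc m) h)

E-cong : ∀ {f g} k m → f ≐ g → E k m f ≐ E k m g
E-cong zero    m h = h
E-cong (suc k) m h = D-cong m (E-cong k (suc m) h)

E-causal : ∀ {f} k m → Causal f → Causal (E k m f)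
E-causal zero    m c = c
E-causal (suc k) m c = D-causal m (E-causal k (suc m) c)

E-shift : ∀ k m c f → E k m (shift c f) ≐ shift c (E k m f)
E-shift zero    m c f x = refl
E-shift (suc k) m c f x =
  trans (D-cong m (E-shift k (suc m) c f) x) (D-shift m c (E k (suc m) f) x)

E-D : ∀ k m a f → E k m (D a f) ≐ D a (E k m f)
E-D zero    m a f x = refl
E-D (suc k) m a f x =
  trans (D-cong m (E-D k (suc m) a f) x) (D-comm m a (E k (suc m) f) x)

E-snoc : ∀ k m f → E (suc k) m f ≐ D (k ℕ.+ m) (E k m f)
E-snoc zero    m f x = refl
E-snoc (suc k) m f x =
  trans (D-cong m (E-snoc k (suc m) f) x)
 (trans (D-comm m (k ℕ.+ suc m) (E k (suc m) f) x)
        (cong (λ i → D i (D m (E k (suc m) f)) x) (ℕ.+-suc k m)))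

E-combine : ∀ k m f g → E k m (λ x → f x - g x) ≐ λ x → E k m f x - E k m g x
E-combine zero    m f g x = refl
E-combine (suc k) m f g x =
  trans (D-cong m (E-combine k (suc m) f g) x)
        (val (E k (suc m) f x) (E k (suc m) g x) (E k (suc m) f (x - + m)) (E k (suc m) g (x - + m)))
  where
  val : ∀ p q r s → (p - q) - (r - s) ≡ (p - r) - (q - s)
  val = solve-∀

E-injective : ∀ {f g} k m → Causal f → Causal g → E k (suc m) f ≐ E k (suc m) g → f ≐ g
E-injective zero    m cf cg h = h
E-injective (suc k) m cf cg h =
  E-injective k (suc m) cf cg
    (D-injective m (E-causal k _ cf) (E-causal k _ cg) h)

-- Division by 1 - q^k

geomUpTo : ℕ → ℕ → Series → Series
geomUpTo zero    k f x = 0ℤ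
geomUpTo (suc b) k f x = f x + geomUpTo b k f (x - + k)

-- f / (1 - q^k); the truncation at ∣x∣ + 1 terms is harmless for causal f and k ≥ 1.
geom : ℕ → Series → Series
geom k f x = geomUpTo (suc ∣ x ∣) k f x

geomUpTo-causal : ∀ {f} b k → Causal f → Causal (geomUpTo b k f)
geomUpTo-causal zero    k c x lt = refl
geomUpTo-causal (suc b) k c x lt = cong₂ _+_ (c x lt) (geomUpTo-causal b k c _ (x-k<b k lt))

geomUpTo-stable : ∀ {f} j b k → Causal f →
                  geomUpTo b (suc k) f ≗ geomUpTo (b ℕ.+ j) (suc k) f below + b
geomUpTo-stable j zero    k c x lt = sym (geomUpTo-causal j (suc k) c x lt)
geomUpTo-stable {f} j (suc b) k c x lt = cong (λ s → f x + s) (geomUpTo-stable j b k c _ (x-suc<b k lt))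

geom-causal : ∀ {f} k → Causal f → Causal (geom k f)
geom-causal k c x lt = geomUpTo-causal (suc ∣ x ∣) k c x lt

geom-unfold : ∀ {f} k → Causal f → ∀ x → geom (suc k) f x ≡ f x + geom (suc k) f (x - + suc k)
geom-unfold {f} k c x = cong (λ s → f x + s)
  -- The two sides are truncated after different numbers of terms; both are compared with a
  -- truncation at the sum of the two lengths.
  (trans (geomUpTo-stable (suc ∣ y ∣) ∣ x ∣ k c y (x-suc<b k (x<1+∣x∣ x)))
  (trans (cong (λ b → geomUpTo b (suc k) f y) (ℕ.+-comm ∣ x ∣ (suc ∣ y ∣)))
         (sym (geomUpTo-stable ∣ x ∣ (suc ∣ y ∣) k c y (x<1+∣x∣ y)))))
  where y = x - + suc k

D-geom : ∀ {f} k → Causal f → D (suc k) (geom (suc k) f) ≐ f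
D-geom {f} k c x =
  trans (cong (_- geom (suc k) f (x - + suc k)) (geom-unfold k c x))
        (val (f x) (geom (suc k) f (x - + suc k)))
  where
  val : ∀ p q → (p + q) - q ≡ p
  val = solve-∀

inv : ℕ → ℕ → Series → Series
inv zero    m f = f
inv (suc k) m f = inv k (suc m) (geom m f)

inv-causal : ∀ {f} k m → Causal f → Causal (inv k (suc m) f)
inv-causal zero    m c = c
inv-causal (suc k) m c = inv-causal k (suc m) (geom-causal (suc m) c)

E-inv : ∀ {f} k m → Causal f → E k (suc m) (inv k (suc m) f) ≐ f
E-inv zero    m c x = refl
E-inv (suc k) m c x =
  trans (D-cong (suc m) (E-inv k (suc m) (geom-causal (suc m) c)) x) (D-geom m c x)

δ-causal : Causal δ
δ-causal -[1+ n ] lt = refl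
δ-causal (+ n) (+<+ ())

-- 1 / (q;q)_p²
g : ℕ → Series
g p = inv p 1 (inv p 1 δ)

g-causal : ∀ p → Causal (g p)
g-causal p = inv-causal p 0 (inv-causal p 0 δ-causal)

-- This equation determines `g p`; identities involving it are checked after multiplication by
-- (q)_p², and `E-injective²` cancels the product.
E-E-g : ∀ p → E p 1 (E p 1 (g p)) ≐ δ
E-E-g p x = trans (E-cong p 1 (E-inv p 0 (inv-causal p 0 δ-causal)) x) (E-inv p 0 δ-causal x)

E-injective² : ∀ {f h} p → Causal f → Causal h →
               E p 1 (E p 1 f) ≐ E p 1 (E p 1 h) → f ≐ h
E-injective² p cf ch eq =
  E-injective p 0 cf ch (E-injective p 0 (E-causal p 1 cf) (E-causal p 1 ch) eq)

E-snoc₁ : ∀ k f → E (suc k) 1 f ≐ E k 1 (D (suc k) f)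
E-snoc₁ k f x =
  trans (E-snoc k 1 f x)
  (trans (cong (λ i → D i (E k 1 f) x) (ℕ.+-comm k 1)) (sym (E-D k 1 (suc k) f x)))

g-step : ∀ p → D (suc p) (D (suc p) (g (suc p))) ≐ g p
g-step p = E-injective² p (D-causal _ (D-causal _ (g-causal (suc p)))) (g-causal p)
  λ x → begin
  E p 1 (E p 1 (D s (D s h))) x  ≡⟨ E-cong p 1 (λ y → trans (sym (E-snoc₁ p (D s h) y)) (E-D (suc p) 1 s h y)) x ⟩
  E p 1 (D s (E (suc p) 1 h)) x  ≡⟨ E-snoc₁ p (E (suc p) 1 h) x ⟨
  E (suc p) 1 (E (suc p) 1 h) x  ≡⟨ E-E-g (suc p) x ⟩
  δ x                            ≡⟨ E-E-g p x ⟨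
  E p 1 (E p 1 (g p)) x          ∎
  where
  s = suc p
  h = g (suc p)

-- The transformation and the pentagonal number theorem

Σ< : ℕ → (ℕ → ℤ) → ℤ
Σ< zero    h = 0ℤ
Σ< (suc M) h = Σ< M h + h M

x-c<0 : ∀ {x b c} → x < b → b ≤ c → x - c < 0ℤ
x-c<0 {x} {b} {c} lt le =
  subst (x - c <_) (ℤ.+-inverseʳ c) (ℤ.+-monoˡ-< (- c) (ℤ.<-≤-trans lt le))

F : ℕ → ℕ → Series
F M m x = Σ< M (λ p → g p (x - + p * + m))

H : ℕ → ℕ → Series
H M m x = Σ< M (λ p → g p (x - + p * + p - + p * + m))

module _ where
  private
    cancel : ∀ a → (a - a) - (a - a) ≡ 0ℤ
    cancel = solve-∀
    regroup : ∀ a b c a′ b′ c′ →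
      ((a + a′) - (b + b′)) - ((b + b′) - (c + c′)) ≡ ((a - b) - (b - c)) + ((a′ - b′) - (b′ - c′))
    regroup = solve-∀

  -- Exact for the truncated sums: M + 1 terms on the left become M on the right, since the term p =
  -- 0 vanishes and p is re-indexed to p + 1.
  F-second-difference : ∀ M m x →
    (F (suc M) m x - F (suc M) (suc m) x) - (F (suc M) (suc m) x - F (suc M) (2 ℕ.+ m) x)
      ≡ F M m (x - + m)
  F-second-difference zero    m x = cancel (0ℤ + g 0 (x - 0ℤ))
  F-second-difference (suc M) m x = begin
    _ ≡⟨ regroup (F (suc M) m x) (F (suc M) (suc m) x) (F (suc M) (2 ℕ.+ m) x)
                 (G (x - + p * + m)) (G (x - + p * + suc m)) (G (x - + p * + (2 ℕ.+ m))) ⟩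
    _ ≡⟨ cong₂ _+_ (F-second-difference M m x)
           (cong₂ (λ y z → (G (x - + p * + m) - G y) - (G y - G z))
                  (arg₁ x (+ p) (+ m)) (arg₂ x (+ p) (+ m))) ⟩
    F M m (x - + m) + D p (D p G) (x - + p * + m)  ≡⟨ cong (λ v → F M m (x - + m) + v) (g-step M _) ⟩
    F M m (x - + m) + g M (x - + p * + m)          ≡⟨ cong (λ y → F M m (x - + m) + g M y) (arg₃ x (+ M) (+ m)) ⟩
    F M m (x - + m) + g M (x - + m - + M * + m)    ∎
    where
    p = suc M
    G = g p
    arg₁ : ∀ x p m → x - p * (1ℤ + m) ≡ x - p * m - p
    arg₁ = solve-∀
    arg₂ : ∀ x p m → x - p * (1ℤ + (1ℤ + m)) ≡ x - p * m - p - p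
    arg₂ = solve-∀
    arg₃ : ∀ x M m → x - (1ℤ + M) * m ≡ x - m - M * m
    arg₃ = solve-∀

  -- As for `F`, but re-indexing changes the exponent by (p + 1)² + (p + 1) m = (m + 1) + p² + p (m
  -- + 2), hence the parameter m + 2 on the right.
  H-second-difference : ∀ M m x →
    (H (suc M) m x - H (suc M) (suc m) x) - (H (suc M) (suc m) x - H (suc M) (2 ℕ.+ m) x)
      ≡ H M (2 ℕ.+ m) (x - + suc m)
  H-second-difference zero    m x = cancel (0ℤ + g 0 (x - 0ℤ - 0ℤ))
  H-second-difference (suc M) m x = begin
    _ ≡⟨ regroup (H (suc M) m x) (H (suc M) (suc m) x) (H (suc M) (2 ℕ.+ m) x)
                 (G (x - + p * + p - + p * + m)) (G (x - + p * + p - + p * + suc m))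
                 (G (x - + p * + p - + p * + (2 ℕ.+ m))) ⟩
    _ ≡⟨ cong₂ _+_ (H-second-difference M m x)
           (cong₂ (λ y z → (G (x - + p * + p - + p * + m) - G y) - (G y - G z))
                  (arg₁ x (+ p) (+ m)) (arg₂ x (+ p) (+ m))) ⟩
    h + D p (D p G) (x - + p * + p - + p * + m)                    ≡⟨ cong (λ v → h + v) (g-step M _) ⟩
    h + g M (x - + p * + p - + p * + m)                            ≡⟨ cong (λ y → h + g M y) (arg₃ x (+ M) (+ m)) ⟩
    h + g M (x - + suc m - + M * + M - + M * + (2 ℕ.+ m))          ∎
    where
    p = suc M
    G = g p
    h = H M (2 ℕ.+ m) (x - + suc m)
    arg₁ : ∀ x p m → x - p * p - p * (1ℤ + m) ≡ x - p * p - p * m - p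
    arg₁ = solve-∀
    arg₂ : ∀ x p m → x - p * p - p * (1ℤ + (1ℤ + m)) ≡ x - p * p - p * m - p - p
    arg₂ = solve-∀
    arg₃ : ∀ x M m → x - (1ℤ + M) * (1ℤ + M) - (1ℤ + M) * m
                   ≡ x - (1ℤ + m) - M * M - M * (1ℤ + (1ℤ + m))
    arg₃ = solve-∀

≤-* : ∀ p m → + p ≤ + p * + suc m
≤-* p m = subst (+ p ≤_) (ℤ.pos-* p (suc m)) (+≤+ (ℕ.m≤m*n p (suc m)))

≤-*′ : ∀ p m → + suc m ≤ + suc p * + suc m
≤-*′ p m = subst (+ suc m ≤_) (ℤ.pos-* (suc p) (suc m)) (+≤+ (ℕ.m≤n*m (suc m) (suc p)))

x-*<b : ∀ {x b} p m → x < b → x - + p * + m < b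
x-*<b {x} {b} p m lt = subst (λ c → x - c < b) (ℤ.pos-* p m) (x-k<b (p ℕ.* m) lt)

F-stable : ∀ M m → F (suc M) (suc m) ≗ F M (suc m) below + M
F-stable M m x lt = trans
  (cong (λ v → F M (suc m) x + v) (g-causal M _ (x-c<0 lt (≤-* M m))))
  (ℤ.+-identityʳ _)

H-stable : ∀ M m → H (suc M) (suc m) ≗ H M (suc m) below + M
H-stable M m x lt = trans
  (cong (λ v → H M (suc m) x + v) (g-causal M _ (x-c<0 (x-*<b M M lt) (≤-* M m))))
  (ℤ.+-identityʳ _)

F-constant : ∀ M m → F (suc M) (suc m) ≗ δ below + suc m
F-constant zero    m x lt = trans (ℤ.+-identityˡ _) (cong δ (ℤ.+-identityʳ x))
F-constant (suc M) m x lt = trans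
  (cong (λ v → F (suc M) (suc m) x + v) (g-causal (suc M) _ (x-c<0 lt (≤-*′ M m))))
  (trans (ℤ.+-identityʳ _) (F-constant M m x lt))

H-constant : ∀ M m → H (suc M) (suc m) ≗ δ below + suc m
H-constant zero    m x lt = trans (ℤ.+-identityˡ _) (cong δ (trans (ℤ.+-identityʳ _) (ℤ.+-identityʳ x)))
H-constant (suc M) m x lt = trans
  (cong (λ v → H (suc M) (suc m) x + v)
    (g-causal (suc M) _ (x-c<0 (x-*<b (suc M) (suc M) lt) (≤-*′ M m))))
  (trans (ℤ.+-identityʳ _) (H-constant M m x lt))

module _ (M : ℕ) where
  private
    f h : ℕ → Series
    f m = F (suc M) (suc m)
    h m = H (suc M) (suc m)

    solve₁ : ∀ a b c d → (a - b) - (b - c) ≡ d → a - d ≡ b - (c - b)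
    solve₁ a b c d eq = trans (cong (λ v → a - v) (sym eq)) (ring a b c)
      where
      ring : ∀ a b c → a - ((a - b) - (b - c)) ≡ b - (c - b)
      ring = solve-∀
    solve₂ : ∀ a b c d → (a - b) - (b - c) ≡ d → b - ((c - d) - b) ≡ a
    solve₂ a b c d eq = trans (cong (λ v → b - ((c - v) - b)) (sym eq)) (ring a b c)
      where
      ring : ∀ a b c → b - ((c - ((a - b) - (b - c))) - b) ≡ a
      ring = solve-∀

  -- 2 f₁ - f₂ is written f₁ - (f₂ - f₁) so that `E-combine`, which treats differences, can be
  -- applied twice.
  F-recurrence : ∀ m → D (suc m) (f m) ≗ (λ x → f (1 ℕ.+ m) x - (f (2 ℕ.+ m) x - f (1 ℕ.+ m) x)) below + M
  F-recurrence m x lt = solve₁ (f m x) (f (1 ℕ.+ m) x) (f (2 ℕ.+ m) x) (f m (x - + suc m))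
    (trans (F-second-difference M (suc m) x) (sym (F-stable M m _ (x-k<b (suc m) lt))))

  H-recurrence : ∀ m → (λ x → h (1 ℕ.+ m) x - (D (2 ℕ.+ m) (h (2 ℕ.+ m)) x - h (1 ℕ.+ m) x)) ≗ h m below + M
  H-recurrence m x lt = solve₂ (h m x) (h (1 ℕ.+ m) x) (h (2 ℕ.+ m) x) (h (2 ℕ.+ m) (x - + (2 ℕ.+ m)))
    (trans (H-second-difference M (suc m) x) (sym (H-stable M (2 ℕ.+ m) _ (x-k<b (2 ℕ.+ m) lt))))

  -- Induction on k with k + m fixed. The finite product stands in for (q^{m+1})_∞, as the omitted
  -- factors have exponents beyond M. The recurrences have order two, hence two base cases; in both
  -- M ≤ m + 1, and all series involved are 1 + O(q^{m+1}).
  E-F≗H : ∀ k m → M ℕ.≤ k ℕ.+ m → E k (suc m) (f m) ≗ h m below + M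
  E-F≗H zero m le x lt = trans (F-constant M m x lt′) (sym (H-constant M m x lt′))
    where lt′ = ℤ.<-≤-trans lt (+≤+ (ℕ.m≤n⇒m≤1+n le))
  E-F≗H (suc zero) m le x lt = begin
    f m x - f m (x - + suc m) ≡⟨ cong (λ v → f m x - v) (trans (F-constant M m _ (x-k<b (suc m) lt′)) (δ-causal _ (x-c<0 lt′ ℤ.≤-refl))) ⟩
    f m x + 0ℤ                ≡⟨ ℤ.+-identityʳ _ ⟩
    f m x                     ≡⟨ F-constant M m x lt′ ⟩
    δ x                       ≡⟨ H-constant M m x lt′ ⟨
    h m x                     ∎
    where lt′ = ℤ.<-≤-trans lt (+≤+ le)
  E-F≗H (suc (suc k)) m le x lt = begin
    E (2 ℕ.+ k) (suc m) (f m) x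
      ≡⟨ E-D (suc k) (2 ℕ.+ m) (suc m) (f m) x ⟨
    E (suc k) (2 ℕ.+ m) (D (suc m) (f m)) x
      ≡⟨ E-local (suc k) (2 ℕ.+ m) (F-recurrence m) x lt ⟩
    E (suc k) (2 ℕ.+ m) (λ y → f₁ y - (f₂ y - f₁ y)) x
      ≡⟨ E-combine (suc k) (2 ℕ.+ m) f₁ (λ y → f₂ y - f₁ y) x ⟩
    E (suc k) (2 ℕ.+ m) f₁ x - E (suc k) (2 ℕ.+ m) (λ y → f₂ y - f₁ y) x
      ≡⟨ cong (λ v → E (suc k) (2 ℕ.+ m) f₁ x - v) (E-combine (suc k) (2 ℕ.+ m) f₂ f₁ x) ⟩
    E (suc k) (2 ℕ.+ m) f₁ x - (D (2 ℕ.+ m) (E k (3 ℕ.+ m) f₂) x - E (suc k) (2 ℕ.+ m) f₁ x)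
      -- Unfolding `E` for `f₂` sets apart the factor 1 - q^{m+2}, the one that `H-recurrence` has
      -- in front of its second series.
      ≡⟨ cong₂ (λ u v → u - (v - u)) (E-F≗H (suc k) (suc m) le₁ x lt)
               (D-local (2 ℕ.+ m) (E-F≗H k (2 ℕ.+ m) le₂) x lt) ⟩
    h (1 ℕ.+ m) x - (D (2 ℕ.+ m) (h (2 ℕ.+ m)) x - h (1 ℕ.+ m) x)
      ≡⟨ H-recurrence m x lt ⟩
    h m x ∎
    where
    f₁ = f (1 ℕ.+ m)
    f₂ = f (2 ℕ.+ m)
    le₁ : M ℕ.≤ suc k ℕ.+ suc m
    le₁ = subst (M ℕ.≤_) (cong suc (sym (ℕ.+-suc k m))) le
    le₂ : M ℕ.≤ k ℕ.+ (2 ℕ.+ m)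
    le₂ = subst (M ℕ.≤_) (trans (cong suc (sym (ℕ.+-suc k m))) (sym (ℕ.+-suc k (suc m)))) le

-- Shanks' finite form of the pentagonal number theorem

tri : ℕ → ℕ
tri zero    = 0
tri (suc s) = suc s ℕ.+ tri s

module Shanks (f : Series) (x : ℤ) where
  sgn : ℕ → ℤ
  sgn s = -1ℤ ^ s

  -- (-1)^s q^{sn + s(s+1)/2} (q)_n / (q)_s, applied to f.
  t : ℕ → ℕ → ℤ
  t n s = sgn s * E (n ℕ.∸ s) (suc s) f (x - + s * + n - + tri s)

  -- Shanks' sum. As a polynomial in q it equals the sum of (-1)^j q^{j(3j-1)/2} over |j| ≤ n; here
  -- it is applied to `f` and read off at `x`.
  V : ℕ → ℤ
  V n = Σ< (suc n) (t n)

  -- Telescoping certificate for the step from n to n + 1. The new factor 1 - q^{n+1} of the product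
  -- contributes `boundary n (suc s)`. Replacing q^{sn} by q^{s(n+1)} contributes the factor -(1 -
  -- q^s), which turns (q)_n/(q)_s into (q)_n/(q)_{s-1} and yields `boundary n s`.
  boundary : ℕ → ℕ → ℤ
  boundary n zero    = 0ℤ
  boundary n (suc s) = sgn s * E (n ℕ.∸ s) (suc s) f (x - + suc s * + suc n - + tri s)

  t-step : ∀ n s → s ℕ.≤ n → t (suc n) s ≡ t n s + (boundary n s - boundary n (suc s))
  t-step n s le = begin
    sgn s * E (suc n ℕ.∸ s) (suc s) f y
      ≡⟨ cong (λ i → sgn s * E i (suc s) f y) (ℕ.+-∸-assoc 1 le) ⟩
    sgn s * E (suc (n ℕ.∸ s)) (suc s) f y
      ≡⟨ cong (sgn s *_) (E-snoc (n ℕ.∸ s) (suc s) f y) ⟩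
    sgn s * (G y - G (y - + (n ℕ.∸ s ℕ.+ suc s)))
      ≡⟨ cong (λ i → sgn s * (G y - G (y - + i)))
           (trans (ℕ.+-suc (n ℕ.∸ s) s) (cong suc (ℕ.m∸n+n≡m le))) ⟩
    sgn s * (G y - G (y - + suc n))
      ≡⟨ cong (λ z → sgn s * (G y - G z)) (arg x (+ s) (+ n) (+ tri s)) ⟩
    sgn s * (G y - G z)
      ≡⟨ ring (sgn s) (G y) (G z) (G w) ⟩
    sgn s * G w + (sgn s * (G y - G w) - sgn s * G z)
      ≡⟨ cong (λ v → sgn s * G w + (v - sgn s * G z)) (lower s le) ⟩
    t n s + (boundary n s - boundary n (suc s)) ∎
    where
    G = E (n ℕ.∸ s) (suc s) f
    y = x - + s * + suc n - + tri s
    z = x - + suc s * + suc n - + tri s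
    w = x - + s * + n - + tri s
    arg : ∀ x s n t → x - s * (1ℤ + n) - t - (1ℤ + n) ≡ x - (1ℤ + s) * (1ℤ + n) - t
    arg = solve-∀
    ring : ∀ c y z w → c * (y - z) ≡ c * w + (c * (y - w) - c * z)
    ring = solve-∀
    lower : ∀ s → s ℕ.≤ n → sgn s * (E (n ℕ.∸ s) (suc s) f (x - + s * + suc n - + tri s)
                                  - E (n ℕ.∸ s) (suc s) f (x - + s * + n - + tri s)) ≡ boundary n s
    lower zero    _  = zr (E n 1 f (x - 0ℤ - 0ℤ))
      where
      zr : ∀ a → 1ℤ * (a - a) ≡ 0ℤ
      zr = solve-∀
    lower (suc s) le = begin
      sgn (suc s) * (K (x - + suc s * + suc n - + tri (suc s)) - K (x - + suc s * + n - + tri (suc s)))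
        ≡⟨ cong₂ (λ a b → sgn (suc s) * (K a - K b)) (a₁ x (+ s) (+ n) (+ tri s)) (a₂ x (+ s) (+ n) (+ tri s)) ⟩
      sgn (suc s) * (K (v - + suc s) - K v)
        ≡⟨ r (sgn s) (K v) (K (v - + suc s)) ⟩
      sgn s * D (suc s) K v
        ≡⟨ cong (λ i → sgn s * E i (suc s) f v) (ℕ.+-∸-assoc 1 le) ⟨
      boundary n (suc s) ∎
      where
      K = E (n ℕ.∸ suc s) (2 ℕ.+ s) f
      v = x - + suc s * + suc n - + tri s
      a₁ : ∀ x s n t → x - (1ℤ + s) * (1ℤ + n) - ((1ℤ + s) + t) ≡ x - (1ℤ + s) * (1ℤ + n) - t - (1ℤ + s)
      a₁ = solve-∀
      a₂ : ∀ x s n t → x - (1ℤ + s) * n - ((1ℤ + s) + t) ≡ x - (1ℤ + s) * (1ℤ + n) - t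
      a₂ = solve-∀
      r : ∀ c a b → (-1ℤ * c) * (b - a) ≡ c * (a - b)
      r = solve-∀

  partial : ∀ n i → i ℕ.≤ suc n → Σ< i (t (suc n)) ≡ Σ< i (t n) - boundary n i
  partial n zero    _  = refl
  partial n (suc s) (s≤s le) =
    trans (cong₂ _+_ (partial n s (ℕ.m≤n⇒m≤1+n le)) (t-step n s le))
          (ring (Σ< s (t n)) (boundary n s) (t n s) (boundary n (suc s)))
    where
    ring : ∀ a b c d → (a - b) + (c + (b - d)) ≡ (a + c) - d
    ring = solve-∀

  -- The boundary term left over by telescoping has the exponent of j = n + 1, and the new summand s
  -- = n + 1 has that of j = -(n + 1).
  V-step : ∀ n → V (suc n) ≡ V n + (sgn (suc n) * f (x - (+ suc n * + suc n + + tri n))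
                                  + sgn (suc n) * f (x - (+ suc n * + suc n + + tri (suc n))))
  V-step n = begin
    Σ< (suc n) (t (suc n)) + t (suc n) (suc n)
      ≡⟨ cong₂ _+_ (partial n (suc n) ℕ.≤-refl) (top n) ⟩
    (V n - boundary n (suc n)) + sgn (suc n) * f (x - q)
      ≡⟨ cong (λ v → (V n - v) + sgn (suc n) * f (x - q)) top′ ⟩
    (V n - sgn n * f (x - q′)) + sgn (suc n) * f (x - q)
      ≡⟨ ring (V n) (sgn n) (f (x - q′)) (f (x - q)) ⟩
    V n + (sgn (suc n) * f (x - q′) + sgn (suc n) * f (x - q)) ∎
    where
    q = + suc n * + suc n + + tri (suc n)
    q′ = + suc n * + suc n + + tri n
    arg : ∀ x a b → x - a - b ≡ x - (a + b)
    arg = solve-∀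
    top : ∀ n → t (suc n) (suc n) ≡ sgn (suc n) * f (x - (+ suc n * + suc n + + tri (suc n)))
    top n = cong₂ (λ i y → sgn (suc n) * E i (2 ℕ.+ n) f y) (ℕ.n∸n≡0 (suc n))
                  (arg x (+ suc n * + suc n) (+ tri (suc n)))
    top′ : boundary n (suc n) ≡ sgn n * f (x - q′)
    top′ = cong₂ (λ i y → sgn n * E i (suc n) f y) (ℕ.n∸n≡0 n) (arg x (+ suc n * + suc n) (+ tri n))
    ring : ∀ v c a b → (v - c * a) + (-1ℤ * c) * b ≡ v + ((-1ℤ * c) * a + (-1ℤ * c) * b)
    ring = solve-∀

  -- A summand with s ≥ 1 starts in degree at least n + s(s+1)/2 ≥ n + 1, beyond x. The summand s =
  -- 0 carries the full product (q)_n.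
  V-value : Causal f → ∀ n → x < + suc n → V n ≡ E n 1 f x
  V-value c n lt = trans (go n) (trans (ℤ.*-identityˡ _) (cong (E n 1 f) (trans (ℤ.+-identityʳ _) (ℤ.+-identityʳ x))))
    where
    neg : ∀ s → x - + suc s * + n - + tri (suc s) < 0ℤ
    neg s = subst (_< 0ℤ) (arg x (+ suc s * + n) (+ tri (suc s)))
      (x-c<0 lt (subst (+ suc n ≤_) (cong (_+ + tri (suc s)) (ℤ.pos-* (suc s) n))
        (+≤+ (subst (ℕ._≤ suc s ℕ.* n ℕ.+ tri (suc s)) (ℕ.+-comm n 1)
          (ℕ.+-mono-≤ (ℕ.m≤m+n n (s ℕ.* n)) (s≤s z≤n))))))
      where
      arg : ∀ x a b → x - (a + b) ≡ x - a - b
      arg = solve-∀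
    go : ∀ i → Σ< (suc i) (t n) ≡ t n 0
    go zero    = ℤ.+-identityˡ _
    go (suc i) = trans (cong₂ _+_ (go i)
      (trans (cong (sgn (suc i) *_) (E-causal (n ℕ.∸ suc i) (2 ℕ.+ i) c _ (neg i))) (ℤ.*-zeroʳ (sgn (suc i)))))
      (ℤ.+-identityʳ _)

-- Pentagonal exponents and the sum over all integers

double-tri : ∀ n → + tri n * + 2 ≡ + n * + suc n
double-tri zero    = refl
double-tri (suc n) = begin
  (+ suc n + + tri n) * + 2      ≡⟨ ℤ.*-distribʳ-+ (+ 2) (+ suc n) (+ tri n) ⟩
  + suc n * + 2 + + tri n * + 2  ≡⟨ cong (λ v → + suc n * + 2 + v) (double-tri n) ⟩
  + suc n * + 2 + + n * + suc n  ≡⟨ ring (+ n) ⟩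
  + suc n * + suc (suc n)        ∎
  where
  ring : ∀ n → (1ℤ + n) * + 2 + n * (1ℤ + n) ≡ (1ℤ + n) * (1ℤ + (1ℤ + n))
  ring = solve-∀

halve : ∀ {i} q → i ≡ + q * + 2 → i / + 2 ≡ + q
halve q refl = trans (cong (_/ + 2) (sym (ℤ.pos-* q 2)))
  (trans (ℤ.*-identityˡ _) (cong +_ (ℕ.m*n/n≡m q 2)))

pentagonal-pos : ∀ n → pentagonal (+ suc n) ≡ + suc n * + suc n + + tri n
pentagonal-pos n = trans (halve (suc n ℕ.* suc n ℕ.+ tri n) (begin
  + suc n * (+ 3 * + suc n - 1ℤ)            ≡⟨ ring (+ n) ⟩
  + suc n * + suc n * + 2 + + n * + suc n   ≡⟨ cong (λ v → + suc n * + suc n * + 2 + v) (double-tri n) ⟨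
  + suc n * + suc n * + 2 + + tri n * + 2   ≡⟨ ℤ.*-distribʳ-+ (+ 2) (+ suc n * + suc n) (+ tri n) ⟨
  (+ suc n * + suc n + + tri n) * + 2       ∎)) refl
  where
  ring : ∀ n → (1ℤ + n) * (+ 3 * (1ℤ + n) - 1ℤ) ≡ (1ℤ + n) * (1ℤ + n) * + 2 + n * (1ℤ + n)
  ring = solve-∀

pentagonal-neg : ∀ n → pentagonal -[1+ n ] ≡ + suc n * + suc n + + tri (suc n)
pentagonal-neg n = trans (halve (suc n ℕ.* suc n ℕ.+ tri (suc n)) (begin
  (- + suc n) * (+ 3 * (- + suc n) - 1ℤ)            ≡⟨ ring (+ n) ⟩
  + suc n * + suc n * + 2 + + suc n * + suc (suc n) ≡⟨ cong (λ v → + suc n * + suc n * + 2 + v) (double-tri (suc n)) ⟨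
  + suc n * + suc n * + 2 + + tri (suc n) * + 2     ≡⟨ ℤ.*-distribʳ-+ (+ 2) (+ suc n * + suc n) (+ tri (suc n)) ⟨
  (+ suc n * + suc n + + tri (suc n)) * + 2         ∎)) refl
  where
  ring : ∀ n → (- (1ℤ + n)) * (+ 3 * (- (1ℤ + n)) - 1ℤ) ≡ (1ℤ + n) * (1ℤ + n) * + 2 + (1ℤ + n) * (1ℤ + (1ℤ + n))
  ring = solve-∀

summand : Series → ℤ → ℤ → ℤ
summand f x j = sign j * f (x - pentagonal j)

symmetricSum-V : ∀ f x n → symmetricSum (summand f x) n ≡ Shanks.V f x n
symmetricSum-V f x zero    = sym (trans (ℤ.+-identityˡ _) (cong (λ y → 1ℤ * f y) (ℤ.+-identityʳ (x - 0ℤ))))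
symmetricSum-V f x (suc n) = begin
  (symmetricSum (summand f x) n + summand f x (+ suc n)) + summand f x -[1+ n ]
    ≡⟨ ℤ.+-assoc (symmetricSum (summand f x) n) _ _ ⟩
  symmetricSum (summand f x) n + (summand f x (+ suc n) + summand f x -[1+ n ])
    ≡⟨ cong₂ _+_ (symmetricSum-V f x n)
        (cong₂ (λ a b → Shanks.sgn f x (suc n) * f (x - a) + Shanks.sgn f x (suc n) * f (x - b))
          (pentagonal-pos n) (pentagonal-neg n)) ⟩
  _ ≡⟨ Shanks.V-step f x n ⟨
  Shanks.V f x (suc n) ∎

∣j∣≤pentagonal : ∀ j → + ∣ j ∣ ≤ pentagonal j
∣j∣≤pentagonal (+ zero)  = +≤+ z≤n
∣j∣≤pentagonal (+ suc n) = subst (+ suc n ≤_) (sym (pentagonal-pos n))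
  (+≤+ (ℕ.≤-trans (ℕ.m≤m*n (suc n) (suc n)) (ℕ.m≤m+n _ (tri n))))
∣j∣≤pentagonal -[1+ n ]  = subst (+ suc n ≤_) (sym (pentagonal-neg n))
  (+≤+ (ℕ.≤-trans (ℕ.m≤m*n (suc n) (suc n)) (ℕ.m≤m+n _ (tri (suc n)))))

isSumOverℤ : ∀ {f s} → Causal f → ∀ n → E (suc n) 1 f (+ n) ≡ s → IsSumOverℤ (summand f (+ n)) s
isSumOverℤ {f} c n eq = suc n
  , (λ j lt → trans
      (cong (sign j *_) (c _ (x-c<0 (+<+ (ℕ.<-trans (ℕ.n<1+n n) lt)) (∣j∣≤pentagonal j))))
      (ℤ.*-zeroʳ (sign j)))
  , sym (trans (symmetricSum-V f (+ n) (suc n))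
      (trans (Shanks.V-value f (+ n) c (suc n) (+<+ (ℕ.m≤n⇒m≤1+n ℕ.≤-refl))) eq))

-- Generating functions of classes of lists

Class : Set₁
Class = List ℕ → Set

infix 4 _⊆_ _≅_ _#_
_⊆_ _≅_ _#_ : Class → Class → Set
P ⊆ Q = ∀ {xs} → P xs → Q xs
P ≅ Q = P ⊆ Q × Q ⊆ P
P # Q = ∀ {xs} → P xs → Q xs → ⊥

∅ : Class
∅ _ = ⊥

infixr 5 _∪_
_∪_ : Class → Class → Class
(P ∪ Q) xs = P xs ⊎ Q xs

image : (List ℕ → List ℕ) → Class → Class
image φ P ys = ∃ λ xs → P xs × ys ≡ φ xs

⋃< : ℕ → (ℕ → Class) → Class
⋃< M P xs = ∃ λ p → p ℕ.< M × P p xs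

-- Lists are counted, not proofs: a class may hold of a list in several ways, as `Unimodal` does
-- when the largest part is repeated. The size is an integer so that it can be transported along
-- identities of series.
record HasSize (P : Class) (z : ℤ) : Set where
  constructor enumeration
  field
    elements : List (List ℕ)
    unique   : Unique elements
    sound    : ∀ {xs} → xs ∈ elements → P xs
    complete : P ⊆ (_∈ elements)
    size     : + length elements ≡ z

size-unique : ∀ {P Q a b} → P ≅ Q → HasSize P a → HasSize Q b → a ≡ b
size-unique (P⊆Q , Q⊆P) (enumeration xs u s c refl) (enumeration ys v t d refl) =
  cong +_ (↭-length (∼bag⇒↭ (unique∧set⇒bag u v (mk⇔ (d ∘ P⊆Q ∘ s) (c ∘ Q⊆P ∘ t)))))

size-cong : ∀ {P Q z} → P ≅ Q → HasSize P z → HasSize Q z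
size-cong (P⊆Q , Q⊆P) (enumeration xs u s c e) = enumeration xs u (P⊆Q ∘ s) (c ∘ Q⊆P) e

size-∅ : HasSize ∅ 0ℤ
size-∅ = enumeration [] [] (λ ()) (λ ()) refl

size-∪ : ∀ {P Q a b} → P # Q → HasSize P a → HasSize Q b → HasSize (P ∪ Q) (a + b)
size-∪ dis (enumeration xs u s c refl) (enumeration ys v t d refl) = enumeration
  (xs ++ ys)
  (Unique.++⁺ u v λ (i , j) → dis (s i) (t j))
  (λ i → [ inj₁ ∘ s , inj₂ ∘ t ]′ (∈-++⁻ xs i))
  [ ∈-++⁺ˡ ∘ c , ∈-++⁺ʳ xs ∘ d ]′
  (cong +_ (length-++ xs))

size-image : ∀ {P φ z} → Injective _≡_ _≡_ φ → HasSize P z → HasSize (image φ P) z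
size-image {P} {φ} inj (enumeration xs u s c e) = enumeration
  (map φ xs)
  (Unique.map⁺ inj u)
  (λ i → let ys , j , eq = ∈-map⁻ φ i in ys , s j , eq)
  (λ { (ys , p , refl) → ∈-map⁺ φ (c p) })
  (trans (cong +_ (length-map φ xs)) e)

size-⋃< : ∀ M {P : ℕ → Class} {h} → (∀ {p q} → p ℕ.< q → P p # P q) →
          (∀ p → HasSize (P p) (h p)) → HasSize (⋃< M P) (Σ< M h)
size-⋃< zero    dis sz = size-cong ((λ ()) , λ { (_ , () , _) }) size-∅
size-⋃< (suc M) {P} dis sz = size-cong (to , from)
  (size-∪ (λ { (p , lt , x) y → dis lt x y }) (size-⋃< M dis sz) (sz M))
  where
  to : ⋃< M P ∪ P M ⊆ ⋃< (suc M) P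
  to (inj₁ (p , lt , x)) = p , ℕ.m≤n⇒m≤1+n lt , x
  to (inj₂ x)            = M , ℕ.≤-refl , x
  from : ⋃< (suc M) P ⊆ ⋃< M P ∪ P M
  from (p , s≤s le , x) with ℕ.m≤n⇒m<n∨m≡n le
  ... | inj₁ lt   = inj₁ (p , lt , x)
  ... | inj₂ refl = inj₂ x

OfSum : ℤ → Class → Class
OfSum n P xs = P xs × + sum xs ≡ n

-- f is the generating function of P, weighted by the sum of the parts.
GF : Class → Series → Set
GF P f = ∀ n → HasSize (OfSum n P) (f n)

OfSum-neg : ∀ {P x} → x < 0ℤ → OfSum x P ≅ ∅
OfSum-neg -<+ = (λ { (_ , ()) }) , λ ()

GF-causal : ∀ {P f} → GF P f → Causal f
GF-causal gf x lt = size-unique (OfSum-neg lt) (gf x) size-∅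

GF-cong : ∀ {P Q f} → P ≅ Q → GF P f → GF Q f
GF-cong (to , from) gf n =
  size-cong ((λ (p , e) → to p , e) , (λ (q , e) → from q , e)) (gf n)

GF-≐ : ∀ {P f h} → f ≐ h → GF P f → GF P h
GF-≐ {P} eq gf n = subst (HasSize (OfSum n P)) (eq n) (gf n)

GF-[] : GF (_≡ []) δ
GF-[] (+ zero)  = enumeration ([] ∷ []) ([] ∷ []) (λ { (here refl) → refl , refl })
  (λ { (refl , _) → here refl }) refl
GF-[] (+ suc n) = size-cong ((λ ()) , λ { (refl , ()) }) size-∅
GF-[] -[1+ n ]  = size-cong ((λ ()) , λ { (refl , ()) }) size-∅

x-k≡y : ∀ {x k y} → k + y ≡ x → y ≡ x - k
x-k≡y {x} {k} {y} refl = ring k y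
  where
  ring : ∀ k y → y ≡ (k + y) - k
  ring = solve-∀

k+[x-k] : ∀ k x → k + (x - k) ≡ x
k+[x-k] = solve-∀

OfSum-image : ∀ {P φ} k → (∀ {xs} → P xs → sum (φ xs) ≡ k ℕ.+ sum xs) → ∀ n →
              image φ (OfSum (n - + k) P) ≅ OfSum n (image φ P)
OfSum-image {P} {φ} k wt n = to , from
  where
  to : image φ (OfSum (n - + k) P) ⊆ OfSum n (image φ P)
  to (xs , (p , e) , refl) =
    (xs , p , refl) , trans (cong +_ (wt p)) (trans (cong (λ s → + k + s) e) (k+[x-k] (+ k) n))
  from : OfSum n (image φ P) ⊆ image φ (OfSum (n - + k) P)
  from ((xs , p , refl) , e) = xs , (p , x-k≡y (trans (cong +_ (sym (wt p))) e)) , refl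

GF-image : ∀ {P φ f} k → Injective _≡_ _≡_ φ → (∀ {xs} → P xs → sum (φ xs) ≡ k ℕ.+ sum xs) →
           GF P f → GF (image φ P) (shift (+ k) f)
GF-image k inj wt gf n = size-cong (OfSum-image k wt n) (size-image inj (gf (n - + k)))

GF-∪ : ∀ {P Q f h} → P # Q → GF P f → GF Q h → GF (P ∪ Q) (λ x → f x + h x)
GF-∪ dis gf gh n = size-cong
  ( (λ { (inj₁ (p , e)) → inj₁ p , e ; (inj₂ (q , e)) → inj₂ q , e })
  , (λ { (inj₁ p , e) → inj₁ (p , e) ; (inj₂ q , e) → inj₂ (q , e) }) )
  (size-∪ (λ (p , _) (q , _) → dis p q) (gf n) (gh n))

GF-∷ : ∀ {P f} k → GF P f → GF (image (k ∷_) P) (shift (+ k) f)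
GF-∷ k = GF-image k (λ { refl → refl }) λ _ → refl

-- P consists of Q and a disjoint copy of P whose sums are raised by k + 1, so its series solves h =
-- f + q^{k+1} h. The enumeration is built by recursion on a bound for the sum.
GF-geom : ∀ {P Q φ f} k → Injective _≡_ _≡_ φ → (∀ {xs} → P xs → sum (φ xs) ≡ suc k ℕ.+ sum xs) →
          Q # image φ P → P ≅ Q ∪ image φ P → GF Q f → GF P (geom (suc k) f)
GF-geom {P} {Q} {φ} {f} k inj wt dis (to , from) gf x = below _ x (x<1+∣x∣ x)
  where
  below : ∀ b x → x < + b → HasSize (OfSum x P) (geom (suc k) f x)
  below zero    x lt = subst (HasSize (OfSum x P)) (sym (geom-causal (suc k) (GF-causal gf) x lt))
    (size-cong (proj₂ (OfSum-neg {P} lt) , proj₁ (OfSum-neg {P} lt)) size-∅)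
  below (suc b) x lt = subst (HasSize (OfSum x P)) (sym (geom-unfold k (GF-causal gf) x))
    (size-cong
      ( (λ { (inj₁ (q , e)) → from (inj₁ q) , e
           ; (inj₂ i) → let j , e = proj₁ (OfSum-image (suc k) wt x) i in from (inj₂ j) , e })
      , (λ (p , e) → [ (λ q → inj₁ (q , e))
                     , (λ i → inj₂ (proj₂ (OfSum-image (suc k) wt x) (i , e))) ]′ (to p)) )
      (size-∪ (λ (q , _) (xs , (p , _) , eq) → dis q (xs , p , eq)) (gf x)
        (size-image inj (below b _ (x-suc<b k lt)))))

-- Stacks and crank classes

data Star (k : ℕ) (Q : Class) : Class where
  base : Q ⊆ Star k Q
  step : ∀ {xs} → Star k Q xs → Star k Q (k ∷ xs)

-- Parts a + 1, …, a + j, each any number of times, in increasing order, then a list in X.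
Up : ℕ → ℕ → Class → Class
Up zero    a X = X
Up (suc j) a X = Star (suc a) (Up j (suc a) X)

-- Parts a + j, …, a + 1, each any number of times, in decreasing order, then a list in X.
Down : ℕ → ℕ → Class → Class
Down zero    a X = X
Down (suc j) a X = Star (suc (a ℕ.+ j)) (Down j a X)

Repeat : ℕ → ℕ → Class → Class
Repeat zero    k X = X
Repeat (suc m) k X = image (k ∷_) (Repeat m k X)

Nil : Class
Nil = _≡ []

OnesUpTo : ℕ → Class
OnesUpTo zero    = Nil
OnesUpTo (suc d) = OnesUpTo d ∪ Repeat (suc d) 1 Nil

-- The first k entries are weakly decreasing and at least v, and the remaining ones form
-- a list in X; h is the least value allowed for a further entry in front.
data Prefix (v : ℕ) (X : Class) : ℕ → ℕ → Class where
  nil  : ∀ {xs} → X xs → Prefix v X zero v xs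
  cons : ∀ {k h x xs} → h ℕ.≤ x → Prefix v X k h xs → Prefix v X (suc k) x (x ∷ xs)

AtLeast : ℕ → ℕ → Class → Class
AtLeast k v X xs = ∃ λ h → Prefix v X k h xs

-- Conditions on the first entry, if any. They ensure that the copies of a part placed in front by
-- `Star` can be told from what follows, which makes the decomposition unique.
HeadsAtMost HeadsAbove : ℕ → Class → Set
HeadsAtMost b X = ∀ {y ys} → X (y ∷ ys) → y ℕ.≤ b
HeadsAbove  b X = ∀ {y ys} → X (y ∷ ys) → b ℕ.< y

GF-Star : ∀ {k Q f} → (∀ {ys} → ¬ Q (suc k ∷ ys)) → GF Q f → GF (Star (suc k) Q) (geom (suc k) f)
GF-Star {k} {Q} head≢ = GF-geom k (λ { refl → refl }) (λ _ → refl) dis (to , from)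
  where
  dis : Q # image (suc k ∷_) (Star (suc k) Q)
  dis q (_ , _ , refl) = head≢ q
  to : Star (suc k) Q ⊆ Q ∪ image (suc k ∷_) (Star (suc k) Q)
  to (base q) = inj₁ q
  to (step s) = inj₂ (_ , s , refl)
  from : Q ∪ image (suc k ∷_) (Star (suc k) Q) ⊆ Star (suc k) Q
  from (inj₁ q)              = base q
  from (inj₂ (_ , s , refl)) = step s

Up-heads : ∀ {X} j a → HeadsAbove (a ℕ.+ j) X → HeadsAbove a (Up j a X)
Up-heads {X} zero a hd x = subst (λ b → HeadsAbove b X) (ℕ.+-identityʳ a) hd x
Up-heads {X} (suc j) a hd (base u) = ℕ.<-trans (ℕ.n<1+n a)
  (Up-heads j (suc a) (subst (λ b → HeadsAbove b X) (ℕ.+-suc a j) hd) u)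
Up-heads (suc j) a hd (step u) = ℕ.≤-refl

Down-heads : ∀ {X} j a → HeadsAtMost a X → HeadsAtMost (a ℕ.+ j) (Down j a X)
Down-heads zero    a hd x = ℕ.m≤n⇒m≤n+o 0 (hd x)
Down-heads (suc j) a hd {y} u = subst (y ℕ.≤_) (sym (ℕ.+-suc a j)) (go u)
  where
  go : HeadsAtMost (suc (a ℕ.+ j)) (Down (suc j) a _)
  go (base u) = ℕ.m≤n⇒m≤1+n (Down-heads j a hd u)
  go (step u) = ℕ.≤-refl

-- The series is described only by the equation it satisfies; closed forms arise when the products
-- for all pieces of a class are cancelled together.
GF-Up : ∀ {X f} j a → HeadsAbove (a ℕ.+ j) X → GF X f →
        ∃ λ h → GF (Up j a X) h × E j (suc a) h ≐ f
GF-Up zero    a hd gf = _ , gf , λ _ → refl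
GF-Up {X} (suc j) a hd gf =
  let h , gh , eq = GF-Up j (suc a) hd′ gf in
  geom (suc a) h
  , GF-Star (λ u → ℕ.n≮n _ (Up-heads j (suc a) hd′ u)) gh
  , λ x → trans (sym (E-D j (2 ℕ.+ a) (suc a) _ x))
         (trans (E-cong j (2 ℕ.+ a) (D-geom a (GF-causal gh)) x) (eq x))
  where
  hd′ : HeadsAbove (suc a ℕ.+ j) X
  hd′ = subst (λ b → HeadsAbove b X) (ℕ.+-suc a j) hd

GF-Down : ∀ {X f} j a → HeadsAtMost a X → GF X f →
          ∃ λ h → GF (Down j a X) h × E j (suc a) h ≐ f
GF-Down zero    a hd gf = _ , gf , λ _ → refl
GF-Down (suc j) a hd gf =
  let h , gh , eq = GF-Down j a hd gf
      h′ = geom (suc (a ℕ.+ j)) h in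
  h′
  , GF-Star (λ u → ℕ.n≮n _ (Down-heads j a hd u)) gh
  , λ x → begin
    E (suc j) (suc a) h′ x                ≡⟨ E-snoc j (suc a) h′ x ⟩
    D (j ℕ.+ suc a) (E j (suc a) h′) x    ≡⟨ cong (λ k → D k (E j (suc a) h′) x) (ℕ.+-comm j (suc a)) ⟩
    D (suc (a ℕ.+ j)) (E j (suc a) h′) x  ≡⟨ E-D j (suc a) (suc (a ℕ.+ j)) h′ x ⟨
    E j (suc a) (D (suc (a ℕ.+ j)) h′) x  ≡⟨ E-cong j (suc a) (D-geom (a ℕ.+ j) (GF-causal gh)) x ⟩
    E j (suc a) h x                       ≡⟨ eq x ⟩
    _                                     ∎

shift-shift : ∀ a b f → shift (+ a) (shift (+ b) f) ≐ shift (+ (a ℕ.+ b)) f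
shift-shift a b f x = cong f (ring x (+ a) (+ b))
  where
  ring : ∀ x a b → x - a - b ≡ x - (a + b)
  ring = solve-∀

shift-0 : ∀ f → f ≐ shift 0ℤ f
shift-0 f x = cong f (sym (ℤ.+-identityʳ x))

GF-Repeat : ∀ {X f} m k → GF X f → GF (Repeat m k X) (shift (+ (m ℕ.* k)) f)
GF-Repeat {f = f} zero    k gf = GF-≐ (shift-0 f) gf
GF-Repeat {f = f} (suc m) k gf = GF-≐ (shift-shift k (m ℕ.* k) f) (GF-∷ k (GF-Repeat m k gf))

incrementFirst : ℕ → List ℕ → List ℕ
incrementFirst zero    xs       = xs
incrementFirst (suc k) []       = []
incrementFirst (suc k) (x ∷ xs) = suc x ∷ incrementFirst k xs

incrementFirst-injective : ∀ k → Injective _≡_ _≡_ (incrementFirst k)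
incrementFirst-injective zero    eq = eq
incrementFirst-injective (suc k) {[]}    {[]}    eq = refl
incrementFirst-injective (suc k) {x ∷ _} {y ∷ _} eq =
  let p , q = ∷-injective eq in cong₂ _∷_ (ℕ.suc-injective p) (incrementFirst-injective k q)

sum-incrementFirst : ∀ {v X k h xs} → Prefix v X k h xs → sum (incrementFirst k xs) ≡ k ℕ.+ sum xs
sum-incrementFirst (nil _) = refl
sum-incrementFirst {k = suc k} {xs = x ∷ xs} (cons _ l) = cong suc (begin
  x ℕ.+ sum (incrementFirst k xs)  ≡⟨ cong (x ℕ.+_) (sum-incrementFirst l) ⟩
  x ℕ.+ (k ℕ.+ sum xs)             ≡⟨ ℕ.+-assoc x k (sum xs) ⟨
  (x ℕ.+ k) ℕ.+ sum xs             ≡⟨ cong (ℕ._+ sum xs) (ℕ.+-comm x k) ⟩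
  (k ℕ.+ x) ℕ.+ sum xs             ≡⟨ ℕ.+-assoc k x (sum xs) ⟩
  k ℕ.+ (x ℕ.+ sum xs)             ∎)

Prefix-increment : ∀ {v X k h xs} → Prefix v X k h xs → Prefix (suc v) X k (suc h) (incrementFirst k xs)
Prefix-increment (nil x)     = nil x
Prefix-increment (cons le l) = cons (s≤s le) (Prefix-increment l)

Prefix-decrement : ∀ {v X k h xs} → Prefix (suc v) X k h xs →
                   ∃ λ h′ → h ≡ suc h′ × image (incrementFirst k) (Prefix v X k h′) xs
Prefix-decrement (nil x) = _ , refl , _ , nil x , refl
Prefix-decrement (cons le l) with Prefix-decrement l
Prefix-decrement (cons (s≤s le) l) | _ , refl , _ , l′ , refl = _ , refl , _ , cons le l′ , refl

Prefix-weaken : ∀ {v X k h xs} → Prefix (suc v) X (suc k) h xs → Prefix v X (suc k) h xs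
Prefix-weaken (cons le (nil x))       = cons (ℕ.≤-trans (ℕ.n≤1+n _) le) (nil x)
Prefix-weaken (cons le l@(cons _ _))  = cons le (Prefix-weaken l)

Prefix-extend : ∀ {v X k h xs} → Prefix v (image (v ∷_) X) k h xs → Prefix v X (suc k) h xs
Prefix-extend (nil (_ , x , refl)) = cons ℕ.≤-refl (nil x)
Prefix-extend (cons le l)          = cons le (Prefix-extend l)

Prefix-split : ∀ {v X k h xs} → Prefix v X (suc k) h xs →
               Prefix v (image (v ∷_) X) k h xs ⊎ Prefix (suc v) X (suc k) h xs
Prefix-split (cons le (nil x)) with ℕ.m≤n⇒m<n∨m≡n le
... | inj₁ lt   = inj₂ (cons lt (nil x))
... | inj₂ refl = inj₁ (nil (_ , x , refl))
Prefix-split (cons le l@(cons _ _)) = Sum.map (cons le) (cons le) (Prefix-split l)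

Prefix-disjoint : ∀ {v X k h h′ xs} → Prefix v (image (v ∷_) X) k h xs → ¬ Prefix (suc v) X (suc k) h′ xs
Prefix-disjoint (nil (_ , _ , refl)) (cons le (nil _)) = ℕ.n≮n _ le
Prefix-disjoint (cons _ l)           (cons _ l′)       = Prefix-disjoint l l′

-- Either the last of the k entries equals v, or all of them can be decremented:
-- this is what conjugation of partitions would give.
GF-AtLeast : ∀ {X f} k v → GF X f →
             ∃ λ h → GF (AtLeast k v X) h × E k 1 h ≐ shift (+ (k ℕ.* v)) f
GF-AtLeast {f = f} zero v gf =
  _ , GF-cong ((λ x → _ , nil x) , λ { (_ , nil x) → x }) gf , shift-0 f
GF-AtLeast {X} {f} (suc k) v gf =
  let h , gh , eq = GF-AtLeast k v (GF-∷ v gf) in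
  geom (suc k) h
  , GF-geom k (incrementFirst-injective (suc k)) (λ (_ , l) → sum-incrementFirst l) dis (to , from) gh
  , λ x → begin
    E (suc k) 1 (geom (suc k) h) x        ≡⟨ E-snoc₁ k (geom (suc k) h) x ⟩
    E k 1 (D (suc k) (geom (suc k) h)) x  ≡⟨ E-cong k 1 (D-geom k (GF-causal gh)) x ⟩
    E k 1 h x                             ≡⟨ eq x ⟩
    shift (+ (k ℕ.* v)) (shift (+ v) f) x ≡⟨ shift-shift (k ℕ.* v) v f x ⟩
    shift (+ (k ℕ.* v ℕ.+ v)) f x         ≡⟨ cong (λ c → shift (+ c) f x) (ℕ.+-comm (k ℕ.* v) v) ⟩
    shift (+ (suc k ℕ.* v)) f x           ∎
  where
  P = AtLeast (suc k) v X
  Q = AtLeast k v (image (v ∷_) X)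
  φ = incrementFirst (suc k)
  dis : Q # image φ P
  dis (_ , l) (_ , (_ , l′) , refl) = Prefix-disjoint l (Prefix-increment l′)
  to : P ⊆ Q ∪ image φ P
  to (_ , l) = Sum.map (_ ,_)
    (λ l′ → let _ , _ , ys , l″ , eq = Prefix-decrement l′ in ys , (_ , l″) , eq) (Prefix-split l)
  from : Q ∪ image φ P ⊆ P
  from (inj₁ (_ , l))             = _ , Prefix-extend l
  from (inj₂ (_ , (_ , l) , refl)) = _ , Prefix-weaken (Prefix-increment l)

-- Generating functions of stacks and crank classes

Parts≤ : ℕ → Class
Parts≤ p = Down p 0 Nil

Nil-heads : ∀ {b} → HeadsAtMost b Nil
Nil-heads ()

Repeat-heads : ∀ {m k X b} → b ℕ.< k → HeadsAbove b (Repeat (suc m) k X)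
Repeat-heads lt (_ , _ , refl) = lt

-- All m copies of the largest part p + 1 form the middle block and both sides have parts at most p.
-- Thus the decomposition is canonical although the peak position is not.
Stack : ℕ → ℕ → Class
Stack p m = Up p 0 (Repeat m (suc p) (Parts≤ p))

GF-Stack : ∀ p m → GF (Stack p (suc m)) (shift (+ (suc m ℕ.* suc p)) (g p))
GF-Stack p m =
  let r , gr , er = GF-Down p 0 Nil-heads GF-[]
      f , gf , ef = GF-Up p 0 (Repeat-heads {m} ℕ.≤-refl) (GF-Repeat (suc m) (suc p) gr)
  in GF-≐ (E-injective² p (GF-causal gf) (shift-causal c (g-causal p))
    λ x → begin
    E p 1 (E p 1 f) x                 ≡⟨ E-cong p 1 ef x ⟩
    E p 1 (shift (+ c) r) x           ≡⟨ E-shift p 1 (+ c) r x ⟩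
    E p 1 r (x - + c)                 ≡⟨ er (x - + c) ⟩
    δ (x - + c)                       ≡⟨ E-E-g p (x - + c) ⟨
    E p 1 (E p 1 (g p)) (x - + c)     ≡⟨ E-shift p 1 (+ c) (E p 1 (g p)) x ⟨
    E p 1 (shift (+ c) (E p 1 (g p))) x  ≡⟨ E-cong p 1 (E-shift p 1 (+ c) (g p)) x ⟨
    E p 1 (E p 1 (shift (+ c) (g p))) x  ∎) gf
  where c = suc m ℕ.* suc p

AnyStack : ℕ → Class
AnyStack p = Up p 0 (image (suc p ∷_) (Parts≤ (suc p)))

-- Cutting at the first copy of the largest part p + 1 leaves parts at most p before it and at most
-- p + 1 after it. This gives q^{p+1} / ((q)_p (q)_{p+1}), and the missing factor of the second
-- (q)_{p+1} becomes the `D`.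
GF-AnyStack : ∀ p → GF (AnyStack p) (shift (+ suc p) (D (suc p) (g (suc p))))
GF-AnyStack p =
  let r , gr , er = GF-Down (suc p) 0 Nil-heads GF-[]
      f , gf , ef = GF-Up p 0 (Repeat-heads {0} ℕ.≤-refl) (GF-∷ (suc p) gr)
  in GF-≐ (E-injective p 0 (GF-causal gf) (shift-causal s (D-causal s (g-causal s)))
      (E-injective s 0 (E-causal p 1 (GF-causal gf)) (E-causal p 1 (shift-causal s (D-causal s (g-causal s))))
    λ x → begin
    E s 1 (E p 1 f) x                     ≡⟨ E-cong s 1 ef x ⟩
    E s 1 (shift (+ s) r) x               ≡⟨ E-shift s 1 (+ s) r x ⟩
    E s 1 r (x - + s)                     ≡⟨ er (x - + s) ⟩
    δ (x - + s)                           ≡⟨ E-E-g s (x - + s) ⟨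
    E s 1 (E s 1 (g s)) (x - + s)         ≡⟨ E-cong s 1 (E-snoc₁ p (g s)) (x - + s) ⟩
    E s 1 (E p 1 (D s (g s))) (x - + s)   ≡⟨ E-shift s 1 (+ s) (E p 1 (D s (g s))) x ⟨
    E s 1 (shift (+ s) (E p 1 (D s (g s)))) x  ≡⟨ E-cong s 1 (E-shift p 1 (+ s) (D s (g s))) x ⟨
    E s 1 (E p 1 (shift (+ s) (D s (g s)))) x  ∎)) gf
  where s = suc p

Repeat-Nil-unique : ∀ {i j k xs} → Repeat i k Nil xs → Repeat j k Nil xs → i ≡ j
Repeat-Nil-unique {zero}  {zero}  _ _ = refl
Repeat-Nil-unique {zero}  {suc j} refl (_ , _ , ())
Repeat-Nil-unique {suc i} {zero}  (_ , _ , ()) refl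
Repeat-Nil-unique {suc i} {suc j} (_ , a , refl) (_ , b , refl) = cong suc (Repeat-Nil-unique a b)

OnesUpTo⁻ : ∀ d {xs} → OnesUpTo d xs → ∃ λ j → j ℕ.≤ d × Repeat j 1 Nil xs
OnesUpTo⁻ zero    n        = 0 , z≤n , n
OnesUpTo⁻ (suc d) (inj₁ o) = let j , le , r = OnesUpTo⁻ d o in j , ℕ.m≤n⇒m≤1+n le , r
OnesUpTo⁻ (suc d) (inj₂ r) = suc d , ℕ.≤-refl , r

OnesUpTo⁺ : ∀ d {j xs} → j ℕ.≤ d → Repeat j 1 Nil xs → OnesUpTo d xs
OnesUpTo⁺ zero    {zero} le r = r
OnesUpTo⁺ (suc d) le r with ℕ.m≤n⇒m<n∨m≡n le
... | inj₁ (s≤s lt) = inj₁ (OnesUpTo⁺ d lt r)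
... | inj₂ refl     = inj₂ r

Repeat-Nil-heads : ∀ m → HeadsAtMost 1 (Repeat m 1 Nil)
Repeat-Nil-heads (suc m) (_ , _ , refl) = ℕ.≤-refl

OnesUpTo-heads : ∀ d → HeadsAtMost 1 (OnesUpTo d)
OnesUpTo-heads d o = let j , _ , r = OnesUpTo⁻ d o in Repeat-Nil-heads j r

GF-OnesUpTo : ∀ d → ∃ λ f → GF (OnesUpTo d) f × D 1 f ≐ D (suc d) δ
GF-OnesUpTo zero    = δ , GF-[] , λ _ → refl
GF-OnesUpTo (suc d) =
  let f , gf , eq = GF-OnesUpTo d in
  _
  , GF-∪ (λ o r → let j , le , r′ = OnesUpTo⁻ d o in ℕ.<⇒≢ (s≤s le) (Repeat-Nil-unique r′ r))
         gf (GF-Repeat (suc d) 1 GF-[])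
  , λ x → begin
    (f x + δ (x - + (suc d ℕ.* 1))) - (f (x - 1ℤ) + δ (x - 1ℤ - + (suc d ℕ.* 1)))
      ≡⟨ cong (λ k → (f x + δ (x - + k)) - (f (x - 1ℤ) + δ (x - 1ℤ - + k))) (ℕ.*-identityʳ (suc d)) ⟩
    (f x + δ (x - + suc d)) - (f (x - 1ℤ) + δ (x - 1ℤ - + suc d))
      ≡⟨ regroup (f x) (δ (x - + suc d)) (f (x - 1ℤ)) (δ (x - 1ℤ - + suc d)) ⟩
    D 1 f x + (δ (x - + suc d) - δ (x - 1ℤ - + suc d))
      ≡⟨ cong₂ (λ u y → u + (δ (x - + suc d) - δ y)) (eq x) (arg x (+ suc d)) ⟩
    (δ x - δ (x - + suc d)) + (δ (x - + suc d) - δ (x - + (2 ℕ.+ d)))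
      ≡⟨ telescope (δ x) (δ (x - + suc d)) (δ (x - + (2 ℕ.+ d))) ⟩
    D (2 ℕ.+ d) δ x ∎
  where
  regroup : ∀ a b c d → (a + b) - (c + d) ≡ (a - c) + (b - d)
  regroup = solve-∀
  telescope : ∀ a b c → (a - b) + (b - c) ≡ a - c
  telescope = solve-∀
  arg : ∀ x d → x - 1ℤ - d ≡ x - (1ℤ + d)
  arg = solve-∀

CrankNonneg : ℕ → Class
CrankNonneg d = AtLeast d (suc d) (Down d 1 (OnesUpTo d))

-- The parts 2, ..., d + 1 contribute 1/((1 - q²) ... (1 - q^{d+1})) and at most d ones contribute
-- (1 - q^{d+1})/(1 - q). The factor 1 - q^{d+1} cancels and leaves 1/(q)_d, matching the 1/(q)_d
-- from the d parts of size at least d + 1.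
GF-CrankNonneg : ∀ d → GF (CrankNonneg d) (shift (+ (d ℕ.* suc d)) (g d))
GF-CrankNonneg d =
  let o , go , eo = GF-OnesUpTo d
      r , gr , er = GF-Down d 1 (OnesUpTo-heads d) go
      f , gf , ef = GF-AtLeast d (suc d) gr
      er′ : E d 1 r ≐ δ
      er′ = D-injective d (E-causal d 1 (GF-causal gr)) δ-causal λ x → begin
        D (suc d) (E d 1 r) x     ≡⟨ E-D d 1 (suc d) r x ⟨
        E d 1 (D (suc d) r) x     ≡⟨ E-snoc₁ d r x ⟨
        D 1 (E d 2 r) x           ≡⟨ D-cong 1 er x ⟩
        D 1 o x                   ≡⟨ eo x ⟩
        D (suc d) δ x             ∎
  in GF-≐ (E-injective² d (GF-causal gf) (shift-causal c (g-causal d))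
    λ x → begin
    E d 1 (E d 1 f) x                 ≡⟨ E-cong d 1 ef x ⟩
    E d 1 (shift (+ c) r) x           ≡⟨ E-shift d 1 (+ c) r x ⟩
    E d 1 r (x - + c)                 ≡⟨ er′ (x - + c) ⟩
    δ (x - + c)                       ≡⟨ E-E-g d (x - + c) ⟨
    E d 1 (E d 1 (g d)) (x - + c)     ≡⟨ E-shift d 1 (+ c) (E d 1 (g d)) x ⟨
    E d 1 (shift (+ c) (E d 1 (g d))) x  ≡⟨ E-cong d 1 (E-shift d 1 (+ c) (g d)) x ⟨
    E d 1 (E d 1 (shift (+ c) (g d))) x  ∎) gf
  where c = d ℕ.* suc d

CrankZero : ℕ → Class
CrankZero w = AtLeast (suc w) (2 ℕ.+ w) (Down w 1 (Repeat (suc w) 1 Nil))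

-- With s = w + 1, the s large parts contribute s(s + 1) to the exponent and the ones contribute s,
-- in all s² + 2s. As the number of ones is fixed, the factor 1/(1 - q) is absent from one of the
-- two products; hence the `D 1`.
GF-CrankZero : ∀ w → GF (CrankZero w)
  (D 1 (shift (+ (suc w ℕ.* (2 ℕ.+ w) ℕ.+ suc w)) (g (suc w))))
GF-CrankZero w =
  let r , gr , er = GF-Down w 1 (Repeat-Nil-heads (suc w)) (GF-Repeat (suc w) 1 GF-[])
      f , gf , ef = GF-AtLeast s (suc s) gr
  in GF-≐ (E-injective² s (GF-causal gf) (D-causal 1 (shift-causal c (g-causal s)))
    λ x → begin
    E s 1 (E s 1 f) x                      ≡⟨ E-cong s 1 ef x ⟩
    E s 1 (shift (+ (s ℕ.* suc s)) r) x    ≡⟨ E-shift s 1 (+ (s ℕ.* suc s)) r x ⟩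
    D 1 (E w 2 r) (x - + (s ℕ.* suc s))    ≡⟨ D-cong 1 er (x - + (s ℕ.* suc s)) ⟩
    D 1 (shift (+ (s ℕ.* 1)) δ) (x - + (s ℕ.* suc s))
      ≡⟨ D-shift 1 (+ (s ℕ.* suc s)) (shift (+ (s ℕ.* 1)) δ) x ⟨
    D 1 (shift (+ (s ℕ.* suc s)) (shift (+ (s ℕ.* 1)) δ)) x
      ≡⟨ D-cong 1 (λ y → trans (shift-shift (s ℕ.* suc s) (s ℕ.* 1) δ y)
           (cong (λ k → δ (y - + (s ℕ.* suc s ℕ.+ k))) (ℕ.*-identityʳ s))) x ⟩
    D 1 (shift (+ c) δ) x                      ≡⟨ D-cong 1 (λ y → E-E-g s (y - + c)) x ⟨
    D 1 (shift (+ c) (E s 1 (E s 1 (g s)))) x  ≡⟨ D-cong 1 (E-shift s 1 (+ c) (E s 1 (g s))) x ⟨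
    D 1 (E s 1 (shift (+ c) (E s 1 (g s)))) x  ≡⟨ D-cong 1 (E-cong s 1 (E-shift s 1 (+ c) (g s))) x ⟨
    D 1 (E s 1 (E s 1 (shift (+ c) (g s)))) x  ≡⟨ E-D s 1 1 (E s 1 (shift (+ c) (g s))) x ⟨
    E s 1 (D 1 (E s 1 (shift (+ c) (g s)))) x  ≡⟨ E-cong s 1 (E-D s 1 1 (shift (+ c) (g s))) x ⟨
    E s 1 (E s 1 (D 1 (shift (+ c) (g s)))) x  ∎) gf
  where
  s = suc w
  c = s ℕ.* suc s ℕ.+ s

-- Shapes of compositions and partitions

Positive : Class
Positive = All (0 ℕ.<_)

Descending≤ : ℕ → Class
Descending≤ b xs = Linked _≥_ (b ∷ xs)

Bounded : ℕ → Class
Bounded b xs = Descending≤ b xs × Positive xs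

Descending≤-weaken : ∀ {b c} → b ℕ.≤ c → Descending≤ b ⊆ Descending≤ c
Descending≤-weaken le [-]      = [-]
Descending≤-weaken le (l ∷ ls) = ℕ.≤-trans l le ∷ ls

Descending⇒≤ : ∀ {xs} c → Linked _≥_ xs → ∃ λ b → c ℕ.≤ b × Descending≤ b xs
Descending⇒≤ {[]}     c l = c , ℕ.≤-refl , [-]
Descending⇒≤ {x ∷ xs} c l = c ℕ.+ x , ℕ.m≤m+n c x , ℕ.m≤n+m x c ∷ l

Descending≤⇒All : ∀ {b xs} → Descending≤ b xs → All (ℕ._≤ b) xs
Descending≤⇒All [-]      = []
Descending≤⇒All (l ∷ ls) = l ∷ All.map (λ y≤x → ℕ.≤-trans y≤x l) (Descending≤⇒All ls)

multiplicity-≡ : ∀ k xs → multiplicity k (k ∷ xs) ≡ suc (multiplicity k xs)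
multiplicity-≡ k xs = cong length (filter-accept (_≟ k) refl)

multiplicity-≢ : ∀ {k x} xs → x ≢ k → multiplicity k (x ∷ xs) ≡ multiplicity k xs
multiplicity-≢ {k} xs x≢k = cong length (filter-reject (_≟ k) x≢k)

count> : ℕ → List ℕ → ℕ
count> w xs = length (filter (w <?_) xs)

count>-yes : ∀ {w x} xs → w ℕ.< x → count> w (x ∷ xs) ≡ suc (count> w xs)
count>-yes {w} xs lt = cong length (filter-accept (w <?_) lt)

count>-no : ∀ {w x} xs → x ℕ.≤ w → count> w (x ∷ xs) ≡ count> w xs
count>-no {w} xs le = cong length (filter-reject (w <?_) (ℕ.≤⇒≯ le))

count>-none : ∀ {w xs} → All (ℕ._≤ w) xs → count> w xs ≡ 0
count>-none []                  = refl
count>-none (_∷_ {xs = xs} p ps) = trans (count>-no xs p) (count>-none ps)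

Up-base : ∀ {X} j a → X ⊆ Up j a X
Up-base zero    a x = x
Up-base (suc j) a x = base (Up-base j (suc a) x)

Up-cons : ∀ {X} j a {x y ys} → a ℕ.< x → x ℕ.≤ a ℕ.+ j → x ℕ.≤ y → Up j a X (y ∷ ys) → Up j a X (x ∷ y ∷ ys)
Up-cons zero    a a<x x≤a+0 _ _ = contradiction (ℕ.≤-trans x≤a+0 (ℕ.≤-reflexive (ℕ.+-identityʳ a))) (ℕ.<⇒≱ a<x)
Up-cons (suc j) a {x} {y} {ys} a<x x≤a+j x≤y u with ℕ.m≤n⇒m<n∨m≡n a<x
... | inj₂ refl = step u
... | inj₁ lt   = base (Up-cons j (suc a) lt (subst (x ℕ.≤_) (ℕ.+-suc a j) x≤a+j) x≤y (unbase u))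
  where
  unbase : ∀ {Q} → Star (suc a) Q (y ∷ ys) → Q (y ∷ ys)
  unbase (base q) = q
  unbase (step _) = contradiction x≤y (ℕ.<⇒≱ lt)

Up-top : ∀ {X} j a {y ys} → a ℕ.+ j ℕ.< y → Up j a X (y ∷ ys) → X (y ∷ ys)
Up-top zero    a lt u        = u
Up-top (suc j) a {y} lt (base u) = Up-top j (suc a) (subst (ℕ._< y) (ℕ.+-suc a j) lt) u
Up-top (suc j) a {y} lt (step u) = contradiction (ℕ.m≤m+n (suc a) j) (ℕ.<⇒≱ (subst (ℕ._< y) (ℕ.+-suc a j) lt))

Up-map : ∀ {X Y} j a → X ⊆ Y → Up j a X ⊆ Up j a Y
Up-map zero    a f x        = f x
Up-map (suc j) a f (base u) = base (Up-map j (suc a) f u)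
Up-map (suc j) a f (step u) = step (Up-map (suc j) a f u)

Up-elim : ∀ {X P : Class} j a → HeadsAbove (a ℕ.+ j) X →
          (∀ {k xs} → a ℕ.< k → k ℕ.≤ a ℕ.+ j → (∀ {y ys} → xs ≡ y ∷ ys → k ℕ.≤ y) → P xs → P (k ∷ xs)) →
          X ⊆ P → Up j a X ⊆ P
Up-elim zero a hd s b x = b x
Up-elim {X} {P} (suc j) a hd s b = go
  where
  hd′ : HeadsAbove (suc a ℕ.+ j) X
  hd′ = subst (λ b → HeadsAbove b X) (ℕ.+-suc a j) hd
  s′ : ∀ {k xs} → suc a ℕ.< k → k ℕ.≤ suc a ℕ.+ j → (∀ {y ys} → xs ≡ y ∷ ys → k ℕ.≤ y) → P xs → P (k ∷ xs)
  s′ {k} lt le = s (ℕ.<-trans (ℕ.n<1+n a) lt) (subst (k ℕ.≤_) (sym (ℕ.+-suc a j)) le)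
  go : Up (suc j) a X ⊆ P
  go (base u) = Up-elim j (suc a) hd′ s′ b u
  go (step u) = s ℕ.≤-refl (subst (suc a ℕ.≤_) (sym (ℕ.+-suc a j)) (ℕ.m≤m+n (suc a) j))
    (λ { refl → Up-heads (suc j) a hd u }) (go u)

Down-elim : ∀ {X P : Class} j a →
            (∀ {k xs} → a ℕ.< k → k ℕ.≤ a ℕ.+ j → P xs → P (k ∷ xs)) → X ⊆ P → Down j a X ⊆ P
Down-elim zero a s b x = b x
Down-elim {X} {P} (suc j) a s b = go
  where
  go : Down (suc j) a X ⊆ P
  go (base u) = Down-elim j a (λ lt le → s lt (ℕ.≤-trans le (ℕ.+-monoʳ-≤ a (ℕ.n≤1+n j)))) b u
  go (step u) = s (s≤s (ℕ.m≤m+n a j)) (ℕ.≤-reflexive (sym (ℕ.+-suc a j))) (go u)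

Down-descending : ∀ {X} j a → X ⊆ Descending≤ a → Down j a X ⊆ Descending≤ (a ℕ.+ j)
Down-descending zero a b {xs} x = subst (λ c → Descending≤ c xs) (sym (ℕ.+-identityʳ a)) (b x)
Down-descending {X} (suc j) a b {xs} u = subst (λ c → Descending≤ c xs) (sym (ℕ.+-suc a j)) (go u)
  where
  go : Down (suc j) a X ⊆ Descending≤ (suc (a ℕ.+ j))
  go (base u) = Descending≤-weaken (ℕ.n≤1+n _) (Down-descending j a b u)
  go (step u) = ℕ.≤-refl ∷ go u

toDown : ∀ j a xs → Bounded (a ℕ.+ j) xs → Down j a (Bounded a) xs
toDown zero    a xs b = subst (λ c → Bounded c xs) (ℕ.+-identityʳ a) b
toDown (suc j) a xs b = go xs (subst (λ c → Bounded c xs) (ℕ.+-suc a j) b)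
  where
  go : ∀ xs → Bounded (suc (a ℕ.+ j)) xs → Down (suc j) a (Bounded a) xs
  go []       (_ , ps) = base (toDown j a [] ([-] , ps))
  go (y ∷ ys) (l ∷ ls , p ∷ ps) with ℕ.m≤n⇒m<n∨m≡n l
  ... | inj₁ (s≤s le) = base (toDown j a (y ∷ ys) (le ∷ ls , p ∷ ps))
  ... | inj₂ refl     = step (go ys (ls , ps))

Down-map : ∀ {X Y} j a → X ⊆ Y → Down j a X ⊆ Down j a Y
Down-map zero    a f x        = f x
Down-map (suc j) a f (base u) = base (Down-map j a f u)
Down-map (suc j) a f (step u) = step (Down-map (suc j) a f u)

Bounded-0 : Bounded 0 ⊆ Nil
Bounded-0 ([-] , _)          = refl
Bounded-0 (z≤n ∷ _ , () ∷ _)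

toParts≤ : ∀ p → Bounded p ⊆ Parts≤ p
toParts≤ p b = Down-map p 0 Bounded-0 (toDown p 0 _ b)

fromParts≤ : ∀ p → Parts≤ p ⊆ Bounded p
fromParts≤ p d = Down-descending p 0 (λ { refl → [-] }) d
               , Down-elim {P = Positive} p 0 (λ lt _ → lt ∷_) (λ { refl → [] }) d

-- Unimodal compositions as stacks

unimodal-∷ : ∀ {x y ys} → x ℕ.≤ y → Unimodal (y ∷ ys) → Unimodal (x ∷ y ∷ ys)
unimodal-∷ le (t , l , d) = suc t , le ∷ l , d

Peak : ℕ → Class
Peak p xs = ∃ λ ys → xs ≡ suc p ∷ ys × Bounded (suc p) ys

Repeat⊆Peak : ∀ p m → Repeat (suc m) (suc p) (Parts≤ p) ⊆ Peak p
Repeat⊆Peak p zero (ys , d , refl) =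
  let l , ps = fromParts≤ p d in ys , refl , Descending≤-weaken (ℕ.n≤1+n p) l , ps
Repeat⊆Peak p (suc m) (ys , r , refl) with Repeat⊆Peak p m r
... | zs , refl , l , ps = ys , refl , ℕ.≤-refl ∷ l , s≤s z≤n ∷ ps

module _ (p : ℕ) where
  Peak-heads : HeadsAbove p (Peak p)
  Peak-heads (_ , refl , _) = ℕ.≤-refl

  Up-unimodal : Up p 0 (Peak p) ⊆ Unimodal
  Up-unimodal = Up-elim p 0 Peak-heads s (λ { (_ , refl , l , _) → zero , [-] , l })
    where
    s : ∀ {k xs} → 0 ℕ.< k → k ℕ.≤ p → (∀ {y ys} → xs ≡ y ∷ ys → k ℕ.≤ y) → Unimodal xs → Unimodal (k ∷ xs)
    s {xs = _ ∷ _} _ _ le un = unimodal-∷ (le refl) un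

  Up-positive : Up p 0 (Peak p) ⊆ Positive
  Up-positive = Up-elim {P = Positive} p 0 Peak-heads (λ lt _ _ → lt ∷_) λ { (_ , refl , _ , ps) → s≤s z≤n ∷ ps }

  Up-largest : ∀ {xs} → Up p 0 (Peak p) xs → largest xs ≡ suc p
  Up-largest {xs} u = ℕ.≤-antisym
    (max≤v⁺ {xs = xs} z≤n (Up-elim {P = All (ℕ._≤ suc p)} p 0 Peak-heads (λ _ le _ → ℕ.m≤n⇒m≤1+n le ∷_)
      (λ { (_ , refl , l , _) → ℕ.≤-refl ∷ Descending≤⇒All l }) u))
    (v≤max⁺ 0 xs (inj₂ (Any.map ℕ.≤-reflexive (Up-elim {P = suc p ∈_} p 0 Peak-heads (λ _ _ _ → there)
      (λ { (_ , refl , _) → here refl }) u))))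

Stack⊆Up-Peak : ∀ p m → Stack p (suc m) ⊆ Up p 0 (Peak p)
Stack⊆Up-Peak p m = Up-map p 0 (Repeat⊆Peak p m)

AnyStack⊆Up-Peak : ∀ p → AnyStack p ⊆ Up p 0 (Peak p)
AnyStack⊆Up-Peak p = Up-map p 0 λ { (ys , d , refl) → ys , refl , fromParts≤ (suc p) d }

Repeat-multiplicity : ∀ {X c xs} m k → (∀ {ys} → X ys → multiplicity k ys ≡ c) →
                      Repeat m k X xs → multiplicity k xs ≡ m ℕ.+ c
Repeat-multiplicity zero    k h x = h x
Repeat-multiplicity (suc m) k h (ys , r , refl) =
  trans (multiplicity-≡ k ys) (cong suc (Repeat-multiplicity m k h r))

Stack-multiplicity : ∀ p m {xs} → Stack p (suc m) xs → multiplicity (suc p) xs ≡ suc m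
Stack-multiplicity p m = Up-elim {P = λ xs → multiplicity (suc p) xs ≡ suc m} p 0
  (Repeat-heads {m} ℕ.≤-refl)
  (λ {_} {xs} _ le _ eq → trans (multiplicity-≢ xs (ℕ.<⇒≢ (s≤s le))) eq)
  (λ r → trans (Repeat-multiplicity (suc m) (suc p) parts r) (ℕ.+-identityʳ (suc m)))
  where
  parts : ∀ {ys} → Parts≤ p ys → multiplicity (suc p) ys ≡ 0
  parts = Down-elim {P = λ ys → multiplicity (suc p) ys ≡ 0} p 0
    (λ {_} {xs} _ le eq → trans (multiplicity-≢ xs (ℕ.<⇒≢ (s≤s le))) eq) (λ { refl → refl })

Bounded⇒Repeat : ∀ p {xs} → Bounded (suc p) xs → ∃ λ m → Repeat m (suc p) (Parts≤ p) xs
Bounded⇒Repeat p {[]}     b = 0 , toParts≤ p ([-] , [])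
Bounded⇒Repeat p {y ∷ ys} (l ∷ ls , q ∷ ps) with ℕ.m≤n⇒m<n∨m≡n l
... | inj₁ (s≤s le) = 0 , toParts≤ p (le ∷ ls , q ∷ ps)
... | inj₂ refl     = let m , r = Bounded⇒Repeat p (ls , ps) in suc m , _ , r , refl

descending⇒Stack : ∀ {x xs} → Linked _≥_ (x ∷ xs) → Positive (x ∷ xs) →
                   ∃ λ p → ∃ λ m → Stack p (suc m) (x ∷ xs)
descending⇒Stack {suc p} l (_ ∷ ps) =
  let m , r = Bounded⇒Repeat p (l , ps) in p , m , Up-base p 0 (_ , r , refl)

-- Induction along the ascending side. An entry at most p joins the ascending parts. An entry above
-- p forces the next one above p as well, so the block of largest parts has already begun; both
-- equal p + 1 and the block grows by one.
unimodal⇒Stack : ∀ {xs} → Unimodal xs → Positive xs → ∃ λ p → ∃ λ m → Stack p (suc m) xs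
unimodal⇒Stack {x ∷ xs} (zero , _ , d) ps = descending⇒Stack d ps
unimodal⇒Stack {x ∷ y ∷ ys} (suc t , le ∷ l , d) (q ∷ ps)
  with unimodal⇒Stack (t , l , d) ps
... | p , m , u with x ≤? p
... | yes x≤p = p , m , Up-cons p 0 q x≤p le u
... | no  x≰p with Up-top p 0 (ℕ.<-≤-trans (ℕ.≰⇒> x≰p) le) u
... | _ , r , refl with ℕ.≤-antisym le (ℕ.≰⇒> x≰p)
... | refl = p , suc m , Up-base p 0 (_ , (_ , r , refl) , refl)

Stack⊆AnyStack : ∀ p m → Stack p (suc m) ⊆ AnyStack p
Stack⊆AnyStack p m = Up-map p 0 λ r →
  let ys , eq , b = Repeat⊆Peak p m r in ys , toParts≤ (suc p) b , eq

-- Partitions of nonnegative crank and of crank zero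

ones : ∀ {c xs} → Bounded 1 xs → ω xs ≡ c → Repeat c 1 Nil xs
ones {xs = []}         b        refl = refl
ones {xs = zero ∷ _}   (_ , () ∷ _)
ones {xs = suc zero ∷ xs} (_ ∷ ls , _ ∷ ps) refl = _ , ones (ls , ps) refl , refl
ones {xs = suc (suc _) ∷ _} (s≤s () ∷ _ , _)

-- Entries added by `Down` exceed a ≥ q, so the count of q is decided by the innermost list; this
-- hands the number of ones down to the tail.
Down-refine : ∀ {X c xs} j a {q} → q ℕ.≤ a → Down j a X xs → multiplicity q xs ≡ c →
              Down j a (λ ys → X ys × multiplicity q ys ≡ c) xs
Down-refine zero    a le x eq        = x , eq
Down-refine (suc j) a le (base u) eq = base (Down-refine j a le u eq)
Down-refine (suc j) a le (step {xs} u) eq = step (Down-refine (suc j) a le u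
  (trans (sym (multiplicity-≢ xs (≢-sym (ℕ.<⇒≢ (s≤s (ℕ.≤-trans le (ℕ.m≤m+n a j))))))) eq))

Down-multiplicity : ∀ {X c} j a {q} → q ℕ.≤ a → (∀ {ys} → X ys → multiplicity q ys ≡ c) →
                    ∀ {xs} → Down j a X xs → multiplicity q xs ≡ c
Down-multiplicity {c = c} j a {q} le b = Down-elim {P = λ xs → multiplicity q xs ≡ c} j a
  (λ {_} {xs} lt _ eq → trans (multiplicity-≢ xs (≢-sym (ℕ.<⇒≢ (ℕ.≤-<-trans le lt)))) eq) b

Prefix-≥ : ∀ {v X k h xs} → Prefix v X k h xs → v ℕ.≤ h
Prefix-≥ (nil _)     = ℕ.≤-refl
Prefix-≥ (cons le l) = ℕ.≤-trans (Prefix-≥ l) le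

Prefix-elim : ∀ {v X k h} {P : Class} → (∀ {x xs} → v ℕ.≤ x → P xs → P (x ∷ xs)) → X ⊆ P →
              Prefix v X k h ⊆ P
Prefix-elim s b (nil x)     = b x
Prefix-elim s b (cons le l) = s (ℕ.≤-trans (Prefix-≥ l) le) (Prefix-elim s b l)

Prefix-map : ∀ {v X Y k h} → X ⊆ Y → Prefix v X k h ⊆ Prefix v Y k h
Prefix-map f (nil x)     = nil (f x)
Prefix-map f (cons le l) = cons le (Prefix-map f l)

-- The bound q < v is asked for only when an entry stands in front: Durfee side 0 has v = 1, and q =
-- 1 is counted.
Prefix-refine : ∀ {v X k h c xs q} → (0 ℕ.< k → q ℕ.< v) → Prefix v X k h xs → multiplicity q xs ≡ c →
                Prefix v (λ ys → X ys × multiplicity q ys ≡ c) k h xs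
Prefix-refine lt (nil x) eq = nil (x , eq)
Prefix-refine lt (cons {xs = xs} le l) eq = cons le (Prefix-refine (λ _ → lt (s≤s z≤n)) l
  (trans (sym (multiplicity-≢ xs (≢-sym (ℕ.<⇒≢
    (ℕ.<-≤-trans (lt (s≤s z≤n)) (ℕ.≤-trans (Prefix-≥ l) le)))))) eq))

Prefix-descending : ∀ {v X k h} → X ⊆ Descending≤ v → Prefix v X k h ⊆ Descending≤ h
Prefix-descending b (nil x)     = b x
Prefix-descending b (cons le l) = ℕ.≤-refl ∷ Descending≤-weaken le (Prefix-descending b l)

Prefix-count-≥ : ∀ {v X k h xs w} → w ℕ.< v → Prefix v X k h xs → k ℕ.≤ count> w xs
Prefix-count-≥ lt (nil x) = z≤n
Prefix-count-≥ lt (cons {xs = xs} le l) = ℕ.≤-trans (s≤s (Prefix-count-≥ lt l))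
  (ℕ.≤-reflexive (sym (count>-yes xs (ℕ.<-≤-trans lt (ℕ.≤-trans (Prefix-≥ l) le)))))

Prefix-count-≤ : ∀ {v X k h xs w} → X ⊆ All (ℕ._≤ w) → Prefix v X k h xs → count> w xs ℕ.≤ k
Prefix-count-≤ b (nil x) = ℕ.≤-reflexive (count>-none (b x))
Prefix-count-≤ {w = w} b (cons {x = x} {xs = xs} le l) with x ≤? w
... | yes x≤w = ℕ.≤-trans (ℕ.≤-reflexive (count>-no xs x≤w)) (ℕ.m≤n⇒m≤1+n (Prefix-count-≤ b l))
... | no  x≰w = ℕ.≤-trans (ℕ.≤-reflexive (count>-yes xs (ℕ.≰⇒> x≰w))) (s≤s (Prefix-count-≤ b l))

Prefix-length : ∀ {v X k h xs} → Prefix v X k h xs → k ℕ.≤ length xs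
Prefix-length (nil _)    = z≤n
Prefix-length (cons _ l) = s≤s (Prefix-length l)

-- The entry after the first k is at most b on one reading and at least v′ > b on the other. Hence
-- Durfee sides, and likewise numbers of large parts, are unique.
Prefix-clash : ∀ {v v′ X X′ k k′ h h′ b xs} → HeadsAtMost b X → b ℕ.< v′ → k ℕ.< k′ →
               Prefix v X k h xs → ¬ Prefix v′ X′ k′ h′ xs
Prefix-clash hd b<v (s≤s lt) (nil x) (cons le l) =
  ℕ.<⇒≱ (ℕ.<-≤-trans b<v (ℕ.≤-trans (Prefix-≥ l) le)) (hd x)
Prefix-clash hd b<v (s≤s lt) (cons _ l) (cons _ l′) = Prefix-clash hd b<v lt l l′

durfee-step : ∀ {v k h b xs} → Prefix v Positive k h xs → Descending≤ b xs →
              Prefix v (Bounded v) k h xs ⊎ ∃ λ h′ → h′ ℕ.≤ b × Prefix (suc v) Positive (suc k) h′ xs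
durfee-step {xs = []} (nil ps) l = inj₁ (nil ([-] , ps))
durfee-step {v} {xs = y ∷ ys} (nil (p ∷ ps)) (y≤b ∷ l) with y ≤? v
... | yes y≤v = inj₁ (nil (y≤v ∷ l , p ∷ ps))
... | no  y≰v = inj₂ (y , y≤b , cons (ℕ.≰⇒> y≰v) (nil ps))
durfee-step (cons le l) (x≤b ∷ d) with durfee-step l d
... | inj₁ l′              = inj₁ (cons le l′)
... | inj₂ (_ , h′≤x , l′) = inj₂ (_ , x≤b , cons h′≤x l′)

-- Search for d such that d parts are at least d + 1 and the rest are at most d + 1. An unsuccessful
-- round puts one more entry into the prefix, so the length of the list bounds the number of rounds.
durfee : ∀ fuel {d h xs} → length xs ℕ.< d ℕ.+ fuel → Linked _≥_ xs → Prefix (suc d) Positive d h xs →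
         ∃ λ d′ → AtLeast d′ (suc d′) (Bounded (suc d′)) xs
durfee zero {d} {xs = xs} lt _ l = contradiction (Prefix-length l) (ℕ.<⇒≱ (subst (length xs ℕ.<_) (ℕ.+-identityʳ d) lt))
durfee (suc fuel) {d} {xs = xs} lt desc l with durfee-step l (proj₂ (proj₂ (Descending⇒≤ 0 desc)))
... | inj₁ l′           = d , _ , l′
... | inj₂ (_ , _ , l′) = durfee fuel (subst (length xs ℕ.<_) (ℕ.+-suc d fuel) lt) desc l′

CrankNonneg⁺ : ∀ {xs} → Linked _≥_ xs → Positive xs → ω xs ℕ.≤ μ xs → ∃ λ d → CrankNonneg d xs
CrankNonneg⁺ {xs} desc ps le =
  let d , h , l = durfee (suc (length xs)) ℕ.≤-refl desc (nil ps) in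
  d , h , Prefix-map
    (λ (b , eq) → Down-map d 1
      (λ (b′ , eq′) → OnesUpTo⁺ d (few l) (ones b′ eq′)) (Down-refine d 1 ℕ.≤-refl (toDown d 1 _ b) eq))
    (Prefix-refine {q = 1} s≤s l refl)
  where
  -- If ω exceeds d, the parts outside the rectangle are at most d + 1 ≤ ω and do not count towards
  -- μ; hence ω ≤ μ ≤ d.
  few : ∀ {d h} → Prefix (suc d) (Bounded (suc d)) d h xs → ω xs ℕ.≤ d
  few {d} l with ω xs ≤? d
  ... | yes ω≤d = ω≤d
  ... | no  ω≰d = ℕ.≤-trans le (Prefix-count-≤ (λ (b , _) →
    All.map (λ y≤ → ℕ.≤-trans y≤ (ℕ.≰⇒> ω≰d)) (Descending≤⇒All b)) l)

Repeat⊆Bounded : ∀ m → Repeat m 1 Nil ⊆ Bounded 1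
Repeat⊆Bounded zero    refl           = [-] , []
Repeat⊆Bounded (suc m) (_ , r , refl) = let l , ps = Repeat⊆Bounded m r in
  ℕ.≤-refl ∷ l , s≤s z≤n ∷ ps

ω-Repeat : ∀ m {xs} → Repeat m 1 Nil xs → ω xs ≡ m
ω-Repeat m r = trans (Repeat-multiplicity m 1 (λ { refl → refl }) r) (ℕ.+-identityʳ m)

AtLeast-partition : ∀ {X k v j} → j ℕ.< v → X ⊆ Bounded 1 →
                    ∀ {xs} → AtLeast k v (Down j 1 X) xs → Linked _≥_ xs × Positive xs
AtLeast-partition {j = j} lt b (_ , l) =
    Linked.tail (Prefix-descending (λ u → Descending≤-weaken lt (Down-descending j 1 (proj₁ ∘ b) u)) l)
  , Prefix-elim {P = Positive} (λ v≤x → ℕ.≤-<-trans z≤n (ℕ.<-≤-trans lt v≤x) ∷_)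
      (Down-elim {P = Positive} j 1 (λ lt _ → ℕ.<-trans (s≤s z≤n) lt ∷_) (proj₂ ∘ b)) l

OnesUpTo⊆Bounded : ∀ d → OnesUpTo d ⊆ Bounded 1
OnesUpTo⊆Bounded d o = let j , _ , r = OnesUpTo⁻ d o in Repeat⊆Bounded j r

CrankNonneg⁻ : ∀ d {xs} → CrankNonneg d xs → (Linked _≥_ xs × Positive xs) × ω xs ℕ.≤ μ xs
CrankNonneg⁻ zero (_ , nil refl)  = ([] , []) , z≤n
CrankNonneg⁻ d@(suc _) {xs} c@(_ , l) = AtLeast-partition ℕ.≤-refl (OnesUpTo⊆Bounded d) c
  -- By ω ≤ d, the d parts of size at least d + 1 all exceed ω, so d ≤ μ.
  , ℕ.≤-trans ω≤d (Prefix-count-≥ (s≤s ω≤d) l)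
  where
  ω≤d : ω xs ℕ.≤ d
  ω≤d = Prefix-elim {P = λ ys → ω ys ℕ.≤ d}
    (λ {_} {ys} v≤x le → ℕ.≤-trans (ℕ.≤-reflexive (multiplicity-≢ ys (≢-sym (ℕ.<⇒≢ (ℕ.≤-trans (s≤s (s≤s z≤n)) v≤x))))) le)
    (Down-elim {P = λ ys → ω ys ℕ.≤ d} d 1
      (λ {_} {ys} lt _ le → ℕ.≤-trans (ℕ.≤-reflexive (multiplicity-≢ ys (≢-sym (ℕ.<⇒≢ lt)))) le)
      λ o → let j , j≤d , r = OnesUpTo⁻ d o in ℕ.≤-trans (ℕ.≤-reflexive (ω-Repeat j r)) j≤d)
    l

CrankNonneg-disjoint : ∀ {d d′} → d ℕ.< d′ → CrankNonneg d # CrankNonneg d′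
CrankNonneg-disjoint {d} lt (_ , l) (_ , l′) =
  Prefix-clash (Down-heads d 1 (OnesUpTo-heads d)) (s≤s lt) lt l l′

-- For crank zero the cut is made by value instead of by the Durfee rectangle, because μ counts the
-- parts above the prescribed ω.
cutAbove : ∀ w {b xs} → suc w ℕ.≤ b → Bounded b xs →
           ∃ λ h → h ℕ.≤ b × Prefix (suc w) (Bounded w) (count> w xs) h xs
cutAbove w {xs = []} le _ = suc w , le , nil ([-] , [])
cutAbove w {xs = y ∷ ys} le (y≤b ∷ l , p ∷ ps) with y ≤? w
... | yes y≤w = suc w , le , subst (λ k → Prefix (suc w) (Bounded w) k (suc w) (y ∷ ys))
  (sym (count>-none (y≤w ∷ All.map (λ z≤ → ℕ.≤-trans z≤ y≤w) (Descending≤⇒All l))))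
  (nil (y≤w ∷ l , p ∷ ps))
... | no  y≰w = let h , h≤y , q = cutAbove w (ℕ.≰⇒> y≰w) (l , ps) in
  y , y≤b , subst (λ k → Prefix (suc w) (Bounded w) k y (y ∷ ys))
    (sym (count>-yes ys (ℕ.≰⇒> y≰w))) (cons h≤y q)

CrankZero⁺ : ∀ {w xs} → Linked _≥_ xs → Positive xs → ω xs ≡ suc w → μ xs ≡ suc w → CrankZero w xs
CrankZero⁺ {w} {xs} desc ps eω eμ =
  let b , le , l = Descending⇒≤ (2 ℕ.+ w) desc
      h , _ , q = cutAbove (suc w) le (l , ps)
  in h , subst (λ k → Prefix (2 ℕ.+ w) (Down w 1 (Repeat (suc w) 1 Nil)) k h xs)
    (trans (cong (λ i → count> i xs) (sym eω)) eμ)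
    (Prefix-map (λ (b , eq) → Down-map w 1 (λ (b′ , eq′) → ones b′ eq′) (Down-refine w 1 ℕ.≤-refl (toDown w 1 _ b) eq))
      (Prefix-refine {q = 1} (λ _ → s≤s (s≤s z≤n)) q eω))

CrankZero⁻ : ∀ w {xs} → CrankZero w xs → (Linked _≥_ xs × Positive xs) × ω xs ≡ suc w × μ xs ≡ suc w
CrankZero⁻ w {xs} c@(_ , l) = AtLeast-partition (s≤s (ℕ.n≤1+n w)) (Repeat⊆Bounded (suc w)) c
  , ω≡ , trans (cong (λ i → count> i xs) ω≡) (ℕ.≤-antisym (Prefix-count-≤ small l) (Prefix-count-≥ ℕ.≤-refl l))
  where
  ω≡ : ω xs ≡ suc w
  ω≡ = Prefix-elim {P = λ ys → ω ys ≡ suc w}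
    (λ {_} {ys} v≤x eq → trans (multiplicity-≢ ys (≢-sym (ℕ.<⇒≢ (ℕ.≤-trans (s≤s (s≤s z≤n)) v≤x)))) eq)
    (Down-multiplicity w 1 ℕ.≤-refl (ω-Repeat (suc w))) l
  small : Down w 1 (Repeat (suc w) 1 Nil) ⊆ All (ℕ._≤ suc w)
  small u = Descending≤⇒All (Down-descending w 1 (proj₁ ∘ Repeat⊆Bounded (suc w)) u)

CrankZero-disjoint : ∀ {w w′} → w ℕ.< w′ → CrankZero w # CrankZero w′
CrankZero-disjoint {w} lt (_ , l) (_ , l′) =
  Prefix-clash (Down-heads w 1 (Repeat-Nil-heads (suc w))) (s≤s (ℕ.m≤n⇒m≤1+n lt)) (s≤s lt) l l′

-- Counting

size-filter : ∀ {P Q : Class} {z} (Q? : Decidable Q) (e : HasSize P z) →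
              HasSize (λ xs → P xs × Q xs) (+ length (filter Q? (HasSize.elements e)))
size-filter Q? (enumeration xs u s c _) = enumeration (filter Q? xs)
  (Unique.filter⁺ Q? u)
  (λ i → let j , q = ∈-filter⁻ Q? {xs = xs} i in s j , q)
  (λ (p , q) → ∈-filter⁺ Q? (c p) q)
  refl

size-compositions : ∀ n → HasSize (IsComposition n) (+ length (compositions n))
size-compositions n = enumeration (compositions n) (compositions-unique n)
  (compositions-sound n) (compositions-complete n) refl

-- Only finitely many of the classes contain lists of sum x, as the others have size 0.
size-⋃ : ∀ {P : ℕ → Class} {f : ℕ → Series} → (∀ p → GF (P p) (f p)) →
         (∀ {p q} → p ℕ.< q → P p # P q) → ∀ {x} M → (∀ p → M ℕ.≤ p → f p x ≡ 0ℤ) →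
         HasSize (OfSum x (λ xs → ∃ λ p → P p xs)) (Σ< M (λ p → f p x))
size-⋃ {P} gf dis {x} M vanish = size-cong (to , from)
  (size-⋃< M (λ lt (p , _) (q , _) → dis lt p q) (λ p → gf p x))
  where
  to : ⋃< M (λ p → OfSum x (P p)) ⊆ OfSum x (λ xs → ∃ λ p → P p xs)
  to (p , _ , c , e) = (p , c) , e
  empty : ∀ {p xs} → M ℕ.≤ p → ¬ OfSum x (P p) xs
  empty {p} le c with gf p x
  ... | enumeration [] _ _ complete _ with () ← complete c
  ... | enumeration (_ ∷ _) _ _ _ eq with () ← trans eq (vanish p le)
  from : OfSum x (λ xs → ∃ λ p → P p xs) ⊆ ⋃< M (λ p → OfSum x (P p))
  from ((p , c) , e) with p ℕ.<? M
  ... | yes lt = p , lt , c , e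
  ... | no  ge = contradiction (c , e) (empty (ℕ.≮⇒≥ ge))

U : ℕ → Series
U m x = + u m x

U-causal : ∀ m → Causal (U m)
U-causal m -[1+ _ ] _ = refl
U-causal m (+ _) (+<+ ())

F-causal : ∀ M m → Causal (F M m)
F-causal zero    m x lt = refl
F-causal (suc M) m x lt = cong₂ _+_ (F-causal M m x lt) (g-causal M _ (x-*<b M m lt))

Σ<-cong : ∀ M {h k} → (∀ p → h p ≡ k p) → Σ< M h ≡ Σ< M k
Σ<-cong zero    eq = refl
Σ<-cong (suc M) eq = cong₂ _+_ (Σ<-cong M eq) (eq M)

Stack-disjoint : ∀ {m p q} → p ℕ.< q → Stack p (suc m) # Stack q (suc m)
Stack-disjoint {m} {p} {q} lt s t = ℕ.<⇒≢ lt (ℕ.suc-injective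
  (trans (sym (Up-largest p (Stack⊆Up-Peak p m s))) (Up-largest q (Stack⊆Up-Peak q m t))))

AnyStack-disjoint : ∀ {p q} → p ℕ.< q → AnyStack p # AnyStack q
AnyStack-disjoint {p} {q} lt s t = ℕ.<⇒≢ lt (ℕ.suc-injective
  (trans (sym (Up-largest p (AnyStack⊆Up-Peak p s))) (Up-largest q (AnyStack⊆Up-Peak q t))))

U≡F : ∀ m M → U (suc m) ≗ F (suc M) (suc m) below + M
U≡F m M -[1+ n ] lt = sym (F-causal (suc M) (suc m) -[1+ n ] -<+)
U≡F m M (+ n) (+<+ n<M) = trans
  (size-unique (to , from)
    (size-filter (λ xs → multiplicity (largest xs) xs ℕ.≟ suc m)
      (size-filter unimodal? (size-compositions N)))
    (size-⋃ (λ p → GF-Stack p m) (Stack-disjoint {m}) (suc M)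
      λ p le → trans (cong (g p) (arg (+ n) (+ p) (+ m) (ℤ.pos-* (suc m) (suc p))))
        (g-causal p _ (x-c<0 (+<+ (ℕ.<-trans n<M le)) (≤-* p m)))))
  (Σ<-cong (suc M) λ p → cong (g p) (arg (+ n) (+ p) (+ m) (ℤ.pos-* (suc m) (suc p))))
  where
  N = n ℕ.+ suc m
  -- Passing from sum n + m + 1 to index n lowers the exponent (m + 1)(p + 1) of the middle block to
  -- p(m + 1).
  arg : ∀ n p m {k} → k ≡ (1ℤ + m) * (1ℤ + p) → n + (1ℤ + m) - k ≡ n - p * (1ℤ + m)
  arg n p m refl = ring n p m
    where
    ring : ∀ n p m → n + (1ℤ + m) - (1ℤ + m) * (1ℤ + p) ≡ n - p * (1ℤ + m)
    ring = solve-∀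
  to : ∀ {xs} → (IsComposition N xs × Unimodal xs) × multiplicity (largest xs) xs ≡ suc m →
       OfSum (+ N) (λ xs → ∃ λ p → Stack p (suc m) xs) xs
  to {xs} (((ps , e) , un) , eq) with unimodal⇒Stack un ps
  ... | p , k , s = (p , subst (λ i → Stack p i xs)
    (trans (sym (Stack-multiplicity p k s))
      (trans (cong (λ i → multiplicity i xs) (sym (Up-largest p (Stack⊆Up-Peak p k s)))) eq)) s) , cong +_ e
  from : OfSum (+ N) (λ xs → ∃ λ p → Stack p (suc m) xs) ⊆ _
  from {xs} ((p , s) , e) =
    ((Up-positive p s′ , ℤ.+-injective e) , Up-unimodal p s′)
    , trans (cong (λ i → multiplicity i xs) (Up-largest p s′)) (Stack-multiplicity p m s)
    where s′ = Stack⊆Up-Peak p m s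

F-difference : ∀ M x → Σ< M (λ p → shift (+ suc p) (D (suc p) (g (suc p))) x)
                     ≡ F (suc M) 1 x - F (suc M) 2 x
F-difference zero    x = sym (ℤ.+-inverseʳ (0ℤ + g 0 (x - 0ℤ)))
F-difference (suc M) x = begin
  _ ≡⟨ cong₂ (λ s y → s + (g p y - g p (x - + p - + p))) (F-difference M x) (arg₁ x (+ p)) ⟩
  _ ≡⟨ cong (λ y → (F p 1 x - F p 2 x) + (g p (x - + p * 1ℤ) - g p y)) (arg₂ x (+ p)) ⟩
  _ ≡⟨ ring (F p 1 x) (F p 2 x) (g p (x - + p * 1ℤ)) (g p (x - + p * + 2)) ⟩
  _ ∎
  where
  p = suc M
  arg₁ : ∀ x p → x - p ≡ x - p * 1ℤ
  arg₁ = solve-∀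
  arg₂ : ∀ x p → x - p - p ≡ x - p * + 2
  arg₂ = solve-∀
  ring : ∀ a b c d → (a - b) + (c - d) ≡ (a + c) - (b + d)
  ring = solve-∀

U₀≡F₁-F₂ : ∀ M → U 0 ≗ (λ x → F (suc M) 1 x - F (suc M) 2 x) below + M
U₀≡F₁-F₂ M -[1+ n ] lt = sym (cong₂ _-_ (F-causal (suc M) 1 -[1+ n ] -<+) (F-causal (suc M) 2 -[1+ n ] -<+))
-- The convention u_0(0) = 0 matches the cancelling constant terms of F_1 and F_2.
U₀≡F₁-F₂ M (+ zero) lt = sym (cong₂ _-_ (F-constant M 0 0ℤ (+<+ (s≤s z≤n))) (F-constant M 1 0ℤ (+<+ (s≤s z≤n))))
U₀≡F₁-F₂ M (+ suc n) (+<+ n<M) = trans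
  (size-unique (to , from) (size-filter unimodal? (size-compositions N))
    (size-⋃ GF-AnyStack AnyStack-disjoint M
      λ p le → D-causal (suc p) (g-causal (suc p)) _
        (x-c<0 (+<+ (ℕ.<-≤-trans n<M (ℕ.m≤n⇒m≤1+n le))) ℤ.≤-refl)))
  (F-difference M (+ N))
  where
  N = suc n
  to : ∀ {xs} → IsComposition N xs × Unimodal xs → OfSum (+ N) (λ xs → ∃ λ p → AnyStack p xs) xs
  to ((ps , e) , un) = let p , k , s = unimodal⇒Stack un ps in (p , Stack⊆AnyStack p k s) , cong +_ e
  from : OfSum (+ N) (λ xs → ∃ λ p → AnyStack p xs) ⊆ _
  from ((p , s) , e) = let s′ = AnyStack⊆Up-Peak p s in
    (Up-positive p s′ , ℤ.+-injective e) , Up-unimodal p s′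

-- Crank counts as coefficients

size-partitions : ∀ n → HasSize (λ xs → IsComposition n xs × Linked _≥_ xs) (+ length (partitions n))
size-partitions n = size-filter (linked? ℕ._≥?_) (size-compositions n)

-- Only the occurrence of `ω xs` in the test is abstracted; those in the difference and inside `μ`
-- stay, so that `cong` evaluates the test alone.
crank-if : List ℕ → ℕ → ℤ
crank-if xs k = if does (k ℕ.≟ 0) then + largest xs else (+ μ xs - + ω xs)

crank-ω≡0 : ∀ xs → ω xs ≡ 0 → crank xs ≡ + largest xs
crank-ω≡0 xs eq = cong (crank-if xs) eq

crank-ω>0 : ∀ {w} xs → ω xs ≡ suc w → crank xs ≡ + μ xs - + ω xs
crank-ω>0 xs eq = cong (crank-if xs) eq

crank-nonneg⇒ω≤μ : ∀ xs → 0ℤ ≤ crank xs → ω xs ℕ.≤ μ xs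
crank-nonneg⇒ω≤μ xs le = cases (ω xs) refl
  where
  cases : ∀ k → ω xs ≡ k → ω xs ℕ.≤ μ xs
  cases zero    eq = subst (ℕ._≤ μ xs) (sym eq) z≤n
  cases (suc w) eq = ℤ.drop‿+≤+ (ℤ.0≤i-j⇒j≤i (subst (0ℤ ≤_) (crank-ω>0 xs eq) le))

ω≤μ⇒crank-nonneg : ∀ xs → ω xs ℕ.≤ μ xs → 0ℤ ≤ crank xs
ω≤μ⇒crank-nonneg xs le = cases (ω xs) refl
  where
  cases : ∀ k → ω xs ≡ k → 0ℤ ≤ crank xs
  cases zero    eq = subst (0ℤ ≤_) (sym (crank-ω≡0 xs eq)) (+≤+ z≤n)
  cases (suc w) eq = subst (0ℤ ≤_) (sym (crank-ω>0 xs eq)) (ℤ.i≤j⇒0≤j-i (+≤+ le))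

crank-zero⇒ω≡μ : ∀ {x xs} → 0 ℕ.< x → crank (x ∷ xs) ≡ 0ℤ →
                 ∃ λ w → ω (x ∷ xs) ≡ suc w × μ (x ∷ xs) ≡ suc w
crank-zero⇒ω≡μ {x} {xs} 0<x c = cases (ω ys) refl
  where
  ys = x ∷ xs
  cases : ∀ k → ω ys ≡ k → ∃ λ w → ω ys ≡ suc w × μ ys ≡ suc w
  cases zero    eq = contradiction (ℤ.+-injective (trans (sym (crank-ω≡0 ys eq)) c))
    (≢-sym (ℕ.<⇒≢ (v≤max⁺ 0 ys (inj₂ (here 0<x)))))
  cases (suc w) eq = w , eq
    , trans (ℤ.+-injective (ℤ.i-j≡0⇒i≡j (+ μ ys) (+ ω ys) (trans (sym (crank-ω>0 ys eq)) c))) eq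

ω≡μ⇒crank-zero : ∀ {w} xs → ω xs ≡ suc w → μ xs ≡ suc w → crank xs ≡ 0ℤ
ω≡μ⇒crank-zero xs eω eμ = trans (crank-ω>0 xs eω)
  (trans (cong (λ k → + k - + ω xs) (trans eμ (sym eω))) (ℤ.+-inverseʳ (+ ω xs)))

crankNonneg crankZero : ℕ → ℤ
crankNonneg n = + length (filter (λ xs → 0ℤ ℤ.≤? crank xs) (partitions n))
crankZero   n = + length (filter (λ xs → crank xs ℤ.≟ 0ℤ) (partitions n))

crankNonneg≡H : ∀ n M → n ℕ.< M → crankNonneg n ≡ H (suc M) 1 (+ n)
crankNonneg≡H n M n<M = trans
  (size-unique (to , from) (size-filter (λ xs → 0ℤ ℤ.≤? crank xs) (size-partitions n))
    (size-⋃ GF-CrankNonneg CrankNonneg-disjoint (suc M)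
      λ d le → g-causal d _ (x-c<0 (+<+ (ℕ.<-trans n<M le)) (+≤+ (ℕ.m≤m*n d (suc d))))))
  (Σ<-cong (suc M) λ d → cong (g d) (arg (+ n) (+ d) (ℤ.pos-* d (suc d))))
  where
  arg : ∀ n d {k} → k ≡ d * (1ℤ + d) → n - k ≡ n - d * d - d * 1ℤ
  arg n d refl = ring n d
    where
    ring : ∀ n d → n - d * (1ℤ + d) ≡ n - d * d - d * 1ℤ
    ring = solve-∀
  to : ∀ {xs} → (IsComposition n xs × Linked _≥_ xs) × 0ℤ ≤ crank xs →
       OfSum (+ n) (λ xs → ∃ λ d → CrankNonneg d xs) xs
  to {xs} (((ps , e) , l) , c) = CrankNonneg⁺ l ps (crank-nonneg⇒ω≤μ xs c) , cong +_ e
  from : OfSum (+ n) (λ xs → ∃ λ d → CrankNonneg d xs) ⊆ _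
  from {xs} ((d , c) , e) = let (l , ps) , le = CrankNonneg⁻ d c in
    ((ps , ℤ.+-injective e) , l) , ω≤μ⇒crank-nonneg xs le

zeroShift : ℕ → ℕ
zeroShift w = suc w ℕ.* (2 ℕ.+ w) ℕ.+ suc w

-- The classes of crank zero start at p = 1; the term p = 0 of H_2 is `δ` and leaves the correction
-- 1 - q.
H-split : ∀ M x → Σ< M (λ w → D 1 (shift (+ zeroShift w) (g (suc w))) x)
                ≡ D 1 (H (suc M) 2) x - D 1 δ x
H-split zero x = sym (trans
  (cong (λ v → v - D 1 δ x) (cong₂ _-_ (H-1 x) (H-1 (x - 1ℤ))))
  (ℤ.+-inverseʳ (D 1 δ x)))
  where
  H-1 : ∀ y → H 1 2 y ≡ δ y
  H-1 y = trans (ℤ.+-identityˡ _) (cong δ (trans (ℤ.+-identityʳ _) (ℤ.+-identityʳ y)))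
H-split (suc M) x = begin
  _ ≡⟨ cong (λ v → v + D 1 (shift (+ zeroShift M) (g p)) x) (H-split M x) ⟩
  _ ≡⟨ cong₂ (λ y z → (D 1 (H p 2) x - D 1 δ x) + (g p y - g p z)) (arg x) (arg (x - 1ℤ)) ⟩
  _ ≡⟨ ring (H p 2 x) (H p 2 (x - 1ℤ)) (D 1 δ x) (g p (x - + p * + p - + p * + 2))
         (g p (x - 1ℤ - + p * + p - + p * + 2)) ⟩
  _ ∎
  where
  p = suc M
  ring : ∀ a b c d e → ((a - b) - c) + (d - e) ≡ ((a + d) - (b + e)) - c
  ring = solve-∀
  arg : ∀ x → x - + zeroShift M ≡ x - + p * + p - + p * + 2
  arg x = trans (cong (λ k → x - (k + + p)) (ℤ.pos-* p (2 ℕ.+ M))) (solve x (+ M))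
    where
    solve : ∀ x M → x - ((1ℤ + M) * (1ℤ + (1ℤ + M)) + (1ℤ + M))
                  ≡ x - (1ℤ + M) * (1ℤ + M) - (1ℤ + M) * + 2
    solve = solve-∀

crankZero≡H : ∀ n M → 2 ℕ.+ n ℕ.< M → crankZero (2 ℕ.+ n) ≡ D 1 (H (suc M) 2) (+ (2 ℕ.+ n))
crankZero≡H n M n<M = trans
  (size-unique (to , from) (size-filter (λ xs → crank xs ℤ.≟ 0ℤ) (size-partitions N))
    (size-⋃ GF-CrankZero CrankZero-disjoint M
      λ w le → cong₂ _-_ (g-causal (suc w) _ (x-c<0 N<M (bound w le)))
                           (g-causal (suc w) _ (x-c<0 (x-k<b 1 N<M) (bound w le)))))
  -- The correction 1 - q has no coefficient in degree 2 or more, so it evaluates to zero.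
  (trans (H-split M (+ N)) (ℤ.+-identityʳ _))
  where
  N = 2 ℕ.+ n
  N<M : + N < + M
  N<M = +<+ n<M
  bound : ∀ w → M ℕ.≤ w → + M ≤ + zeroShift w
  bound w le = +≤+ (ℕ.≤-trans (ℕ.m≤n⇒m≤1+n le) (ℕ.m≤n+m (suc w) (suc w ℕ.* (2 ℕ.+ w))))
  to : ∀ {xs} → (IsComposition N xs × Linked _≥_ xs) × crank xs ≡ 0ℤ →
       OfSum (+ N) (λ xs → ∃ λ w → CrankZero w xs) xs
  to {x ∷ xs} (((ps@(p ∷ _) , e) , l) , c) = let w , eω , eμ = crank-zero⇒ω≡μ p c in
    (w , CrankZero⁺ l ps eω eμ) , cong +_ e
  from : OfSum (+ N) (λ xs → ∃ λ w → CrankZero w xs) ⊆ _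
  from {xs} ((w , c) , e) = let (l , ps) , eω , eμ = CrankZero⁻ w c in
    ((ps , ℤ.+-injective e) , l) , ω≡μ⇒crank-zero xs eω eμ

C₁≡H : ∀ n .{{_ : NonZero n}} M → n ℕ.< M → C (suc zero) n ≡ H (suc M) 1 (+ n)
-- The only partition of 1 has crank -1, so the prescribed value 0 is the actual count.
C₁≡H 1               M lt = crankNonneg≡H 1 M lt
C₁≡H n@(suc (suc _)) M lt = crankNonneg≡H n M lt

C₂≡H : ∀ n .{{_ : NonZero n}} M → n ℕ.< M → C (suc (suc zero)) n ≡ D 1 (H (suc M) 2) (+ n)
-- H_2 = 1 + O(q²), so (1 - q) H_2 has the coefficient 0 - 1 in degree 1.
C₂≡H 1             M lt = sym (cong₂ _-_ (H-constant M 1 (+ 1) (+<+ ℕ.≤-refl)) (H-constant M 1 (+ 0) (+<+ (s≤s z≤n))))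
C₂≡H (suc (suc n)) M lt = crankZero≡H n M lt

C₀≡C₁-C₂ : ∀ n .{{_ : NonZero n}} → C zero n ≡ C (suc zero) n - C (suc (suc zero)) n
C₀≡C₁-C₂ 1 = refl
C₀≡C₁-C₂ n@(suc (suc _)) = trans (ring (C zero n) (C (suc (suc zero)) n))
  (cong (λ v → v - C (suc (suc zero)) n)
    (size-unique (to , from)
      (size-∪ (λ (_ , lt) (_ , eq) → ℤ.<-irrefl (sym eq) lt)
        (size-filter (λ xs → 0ℤ ℤ.<? crank xs) (size-partitions n))
        (size-filter (λ xs → crank xs ℤ.≟ 0ℤ) (size-partitions n)))
      (size-filter (λ xs → 0ℤ ℤ.≤? crank xs) (size-partitions n))))
  where
  ring : ∀ a b → a ≡ (a + b) - b
  ring = solve-∀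
  Partition : Class
  Partition xs = IsComposition n xs × Linked _≥_ xs
  to : (λ xs → Partition xs × 0ℤ < crank xs) ∪ (λ xs → Partition xs × crank xs ≡ 0ℤ)
     ⊆ (λ xs → Partition xs × 0ℤ ≤ crank xs)
  to (inj₁ (p , lt)) = p , ℤ.<⇒≤ lt
  to (inj₂ (p , eq)) = p , ℤ.≤-reflexive (sym eq)
  from : (λ xs → Partition xs × 0ℤ ≤ crank xs)
       ⊆ (λ xs → Partition xs × 0ℤ < crank xs) ∪ (λ xs → Partition xs × crank xs ≡ 0ℤ)
  from {xs} (p , le) with crank xs ℤ.≟ 0ℤ
  ... | yes eq = inj₂ (p , eq)
  ... | no  ne = inj₁ (p , ℤ.≤∧≢⇒< le (≢-sym ne))

E-F₁ : ∀ n .{{_ : NonZero n}} → E (suc n) 1 (F (2 ℕ.+ n) 1) (+ n) ≡ C (suc zero) n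
E-F₁ n = trans (E-F≗H (suc n) (suc n) 0 (ℕ.m≤m+n (suc n) 0) (+ n) (+<+ ℕ.≤-refl))
  (sym (C₁≡H n (suc n) ℕ.≤-refl))

-- (q)_{n+1} = (1 - q)(q²)_n: the second factor carries F_2 to H_2, and the first is the 1 - q in
-- the series of C_2.
E-F₂ : ∀ n .{{_ : NonZero n}} → E (suc n) 1 (F (2 ℕ.+ n) 2) (+ n) ≡ C (suc (suc zero)) n
E-F₂ n = trans
  (D-local 1 (E-F≗H (suc n) n 1 (ℕ.≤-reflexive (ℕ.+-comm 1 n))) (+ n) (+<+ ℕ.≤-refl))
  (sym (C₂≡H n (suc n) ℕ.≤-refl))

E-U : ∀ n .{{_ : NonZero n}} m → E (suc n) 1 (U (toℕ m)) (+ n) ≡ C m n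
E-U n zero = begin
  E (suc n) 1 (U 0) (+ n)
    ≡⟨ E-local (suc n) 1 (U₀≡F₁-F₂ (suc n)) (+ n) (+<+ ℕ.≤-refl) ⟩
  E (suc n) 1 (λ x → F (2 ℕ.+ n) 1 x - F (2 ℕ.+ n) 2 x) (+ n)
    ≡⟨ E-combine (suc n) 1 (F (2 ℕ.+ n) 1) (F (2 ℕ.+ n) 2) (+ n) ⟩
  E (suc n) 1 (F (2 ℕ.+ n) 1) (+ n) - E (suc n) 1 (F (2 ℕ.+ n) 2) (+ n)
    ≡⟨ cong₂ _-_ (E-F₁ n) (E-F₂ n) ⟩
  C (suc zero) n - C (suc (suc zero)) n
    ≡⟨ C₀≡C₁-C₂ n ⟨
  C zero n ∎
E-U n (suc zero)       = trans (E-local (suc n) 1 (U≡F 0 (suc n)) (+ n) (+<+ ℕ.≤-refl)) (E-F₁ n)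
E-U n (suc (suc zero)) = trans (E-local (suc n) 1 (U≡F 1 (suc n)) (+ n) (+<+ ℕ.≤-refl)) (E-F₂ n)

corollary1p6 : ∀ (n : ℕ) .{{_ : NonZero n}} (m : Fin 3) →
    IsSumOverℤ (λ j → sign j * + u (toℕ m) (+ n - pentagonal j)) (C m n)
corollary1p6 n m = isSumOverℤ (U-causal (toℕ m)) n (E-U n m)
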